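{- There is an absolute constant $c>0$ such that for any positive integers $f,l$ there is an Ising instance (a Hamiltonian $H(S)=\mathrm{const}+\sum_i h_iS_i+\sum_{i<j}J_{ij}S_iS_j$ on $N$ variables $S_i\in\{\pm1\}$, where $N$ can be taken to be any positive multiple of $l^f$) in which every variable has degree $d=f(l-1)$, and which has at least $$2^{N\cdot\left(1-\frac{f\log_2(f\sqrt l/c)}{l}\right)}$$ global minima, all of which are $(2^f-1)$-minima.
   Context: The degree of a variable $i$ is the number of variables $j\neq i$ with $J_{ij}\ne0$. A global minimum is an assignment minimizing $H$. For an integer $k\ge1$, an assignment $A$ is a $k$-minimum if every assignment differing from $A$ in at least one and at most $k$ variables has a strictly larger value of $H$ than $A$. -}

module Defs where

open import Data.Bool using (Bool; true; false)
open import Data.Nat as ℕ using (ℕ; suc)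
open import Data.Integer as ℤ using (ℤ; +_; -_)
open import Data.Fin as Fin using (Fin; toℕ)
open import Data.List using (List; map; foldr; filter; length)
open import Data.Vec using (Vec; lookup)
open import Data.Fin.Base using () renaming (_<_ to _<ᶠ_)
open import Data.Product using (Σ; _×_; _,_)
open import Relation.Nullary using (¬_; Dec; yes; no)
open import Relation.Nullary.Decidable using (¬?; _×-dec_)
open import Relation.Binary.PropositionalEquality using (_≡_)
import Data.Fin.Properties as FinP
import Data.Bool.Properties as BoolP
import Data.Nat.Properties as ℕP
open import Data.List using (allFin)

-- An Ising instance on N variables with integer fields and couplings.
-- The couplings J are stored as a full symmetric matrix; the Hamiltonian
-- only uses the pairs i < j.  The additive constant is irrelevant to
-- minima and degrees and is omitted.
record Ising (N : ℕ) : Set where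
  field
    h    : Fin N → ℤ
    J    : Fin N → Fin N → ℤ
    Jsym : ∀ i j → J i j ≡ J j i

Assignment : ℕ → Set
Assignment N = Vec Bool N

spin : Bool → ℤ
spin true  = + 1
spin false = - (+ 1)

Σℤ : ∀ {N} → (Fin N → ℤ) → ℤ
Σℤ {N} f = foldr ℤ._+_ (+ 0) (map f (allFin N))

H : ∀ {N} → Ising N → Assignment N → ℤ
H {N} I S =
  Σℤ (λ i → Ising.h I i ℤ.* spin (lookup S i))
  ℤ.+ Σℤ (λ i → Σℤ (λ j → pairTerm i j))
  where
  pairTerm : Fin N → Fin N → ℤ
  pairTerm i j with toℕ i ℕ.<? toℕ j
  ... | yes _ = Ising.J I i j ℤ.* spin (lookup S i) ℤ.* spin (lookup S j)
  ... | no _  = + 0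

degree : ∀ {N} → Ising N → Fin N → ℕ
degree {N} I i =
  length (filter (λ j → ¬? (j FinP.≟ i) ×-dec ¬? (Ising.J I i j ℤ.≟ + 0)) (allFin N))

dist : ∀ {N} → Assignment N → Assignment N → ℕ
dist {N} A B =
  length (filter (λ i → ¬? (lookup A i BoolP.≟ lookup B i)) (allFin N))

GlobalMin : ∀ {N} → Ising N → Assignment N → Set
GlobalMin I A = ∀ B → H I A ℤ.≤ H I B

KMin : ∀ {N} → ℕ → Ising N → Assignment N → Set
KMin k I A = ∀ B → 1 ℕ.≤ dist A B → dist A B ℕ.≤ k → H I A ℤ.< H I B

AtLeastGlobalMins : ∀ {N} → Ising N → ℕ → Set
AtLeastGlobalMins {N} I M =
  Σ (Fin M → Assignment N) λ g →
    (∀ a b → g a ≡ g b → a ≡ b) × (∀ a → GlobalMin I (g a))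

{-# OPTIONS --safe #-}
module Submission where

-- The variables are the points of k disjoint cubes [l]^f and the energy is Σ_L (s_L − t_L)², where L runs
-- over the n = fN/l axis-parallel lines and s_L is the sum of the spins on L.  If some assignment attains the
-- target t exactly, the global minima are the assignments attaining it, and the difference of two of them sums
-- to zero along every line, so it vanishes or has at least 2^f nonzero entries.
-- Many assignments share a target: choose q with l ≤ q² ≤ 4l and give a load s the weight 2^−⌊|s|/q⌋.
-- The weights of the integers in [−l, l] add up to at most 4q, while E s_L² = l and Jensen's inequality make the
-- average over all assignments of the product of the weights of the n lines at least 2^−n.  By pigeonhole some t
-- is attained by at least 2^N / (8q)^n assignments.

open import Defs
open import Algebra.Bundles using (CommutativeMonoid)
import Algebra.Properties.CommutativeMonoid.Sum as MonoidSum
open import Data.Bool using (Bool; true; false; if_then_else_)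
import Data.Bool.Properties as BoolP
open import Data.Fin as Fin using (Fin; zero; suc; toℕ; _↑ˡ_; _↑ʳ_; combine; remQuot; splitAt)
open import Data.Fin.Properties
  using (_≟_; any?; splitAt-↑ˡ; splitAt-↑ʳ; join-splitAt; remQuot-combine; combine-remQuot;
         combine-injectiveˡ; combine-injectiveʳ; punchInᵢ≢i)
open import Data.Integer as ℤ using (ℤ; +_; -_; ∣_∣)
import Data.Integer.Properties as ℤP
open import Data.Integer.Tactic.RingSolver using (solve-∀)
open import Data.List as List
  using (List; []; _∷_; _++_; map; foldr; length; filter; tabulate; allFin; upTo; applyUpTo)
open import Data.List.Membership.Propositional using (_∈_)
open import Data.List.Membership.Propositional.Properties
  using (∈-filter⁻; ∈-++⁺ˡ; ∈-++⁺ʳ; ∈-map⁺; ∈-map⁻; ∈-upTo⁺; ∈-lookup)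
open import Data.List.Properties using (map-tabulate; map-upTo; length-map; length-++; map-++; map-∘)
open import Data.List.Relation.Unary.All as All using ([])
open import Data.List.Relation.Unary.AllPairs using ([]; _∷_)
open import Data.List.Relation.Unary.Any using (here; there)
open import Data.List.Relation.Unary.Unique.Propositional using (Unique)
import Data.List.Relation.Unary.Unique.Propositional.Properties as Unique
open import Data.Nat as ℕ using (ℕ; zero; suc; _≤_; z≤n; s≤s; NonZero; _<ᵇ_)
open import Data.Nat.Divisibility using (∣-refl)
open import Data.Nat.DivMod using (m/n*n≤m; +-distrib-/-∣ˡ; n/n≡1)
open import Data.Nat.ListAction using (sum)
open import Data.Nat.ListAction.Properties using (sum-++)
import Data.Nat.Properties as ℕP
open import Data.Nat.Tactic.RingSolver renaming (solve-∀ to ℕ-solve-∀)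
open import Data.Product using (Σ; _×_; _,_; ∃; ∃₂; proj₁; proj₂)
open import Data.Sum using (_⊎_; inj₁; inj₂; map₁)
open import Data.Vec as Vec using (lookup)
import Data.Vec.Functional as Vector
import Data.Vec.Properties as VecP
open import Function using (_∘_; id; _⇔_; mk⇔)
open import Relation.Binary.PropositionalEquality hiding (J)
open import Relation.Nullary using (¬_; Dec; yes; no; does; contradiction)
open import Relation.Nullary.Decidable using (¬?; _×-dec_; dec-true; dec-false; does-⇔; decidable-stable)
open import Relation.Unary using (Pred; Decidable)

open import Algebra.Properties.Semiring.Sum ℕP.+-*-semiring
  using ()
  renaming (sum to ∑; *-distribˡ-sum to ∑-*ˡ; sum-cong-≗ to ∑-cong)
open import Algebra.Properties.CommutativeMonoid.Sum ℕP.*-1-commutativeMonoid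
  using ()
  renaming (sum to ∏)
open import Algebra.Properties.Semiring.Sum ℤP.+-*-semiring
  using ()
  renaming ( sum to ∑ℤ; ∑-distrib-+ to ∑ℤ-+; ∑-comm to ∑ℤ-swap; sum-cong-≗ to sumℤ-cong
           ; *-distribˡ-sum to ∑ℤ-*ˡ; *-distribʳ-sum to ∑ℤ-*ʳ; sum-replicate-zero to ∑ℤ-zero)

∑ℤ-cong : ∀ {n} {f g : Fin n → ℤ} → (∀ i → f i ≡ g i) → ∑ℤ f ≡ ∑ℤ g
∑ℤ-cong = sumℤ-cong

-- The quadratic energy as an Ising Hamiltonian, and its minima.

module Hamiltonian where
  open import Data.Integer using (_+_; _-_; _*_)

  Σℤ≡∑ℤ : ∀ {N} (f : Fin N → ℤ) → Σℤ f ≡ ∑ℤ f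
  Σℤ≡∑ℤ f = trans (cong (foldr _+_ (+ 0)) (map-tabulate id f)) (go f)
    where
    go : ∀ {N} (f : Fin N → ℤ) → foldr _+_ (+ 0) (tabulate f) ≡ ∑ℤ f
    go {zero}  f = refl
    go {suc N} f = cong (λ x → f zero + x) (go (f ∘ suc))

  -- The Boolean test `_<ᵇ_` reduces on two successors, so deleting the first row and column of the
  -- matrix leaves a term of the same form by computation.
  upper : ∀ {N} → (Fin N → Fin N → ℤ) → Fin N → Fin N → ℤ
  upper g i j = if toℕ i <ᵇ toℕ j then g i j else + 0

  -- Induction peels off the first row and the first column, which agree by symmetry. Squaring a
  -- load produces the left side, while `H` runs over pairs `i < j` only.
  ∑ℤ-symmetric : ∀ {N} (g : Fin N → Fin N → ℤ) → (∀ i j → g i j ≡ g j i) →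
    ∑ℤ (λ i → ∑ℤ (g i)) ≡ ∑ℤ (λ i → g i i) + + 2 * ∑ℤ (λ i → ∑ℤ (upper g i))
  ∑ℤ-symmetric {zero}  g gsym = refl
  ∑ℤ-symmetric {suc N} g gsym = begin
    (d + r) + ∑ℤ (λ i → g (suc i) zero + ∑ℤ (g (suc i) ∘ suc))
      ≡⟨ cong (λ x → (d + r) + x) (∑ℤ-+ (λ i → g (suc i) zero) (λ i → ∑ℤ (g (suc i) ∘ suc))) ⟩
    (d + r) + (∑ℤ (λ i → g (suc i) zero) + ∑ℤ (λ i → ∑ℤ (g (suc i) ∘ suc)))
      ≡⟨ cong₂ (λ x y → (d + r) + (x + y)) (∑ℤ-cong (λ i → gsym (suc i) zero))
           (∑ℤ-symmetric (λ i j → g (suc i) (suc j)) (λ i j → gsym (suc i) (suc j))) ⟩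
    (d + r) + (r + (D + + 2 * U))
      ≡⟨ shuffle d r D U ⟩
    -- The zero here is the corner entry of `upper g`; those introduced next are the rest of its
    -- first column.
    (d + D) + + 2 * ((+ 0 + r) + U)
      ≡⟨ cong (λ x → (d + D) + + 2 * ((+ 0 + r) + x)) (∑ℤ-cong (λ i → sym (ℤP.+-identityˡ (∑ℤ λ j → upper g (suc i) (suc j))))) ⟩
    (d + D) + + 2 * ((+ 0 + r) + ∑ℤ (λ i → + 0 + ∑ℤ (λ j → upper g (suc i) (suc j)))) ∎
    where
    open ≡-Reasoning
    d = g zero zero
    r = ∑ℤ (λ j → g zero (suc j))
    D = ∑ℤ (λ i → g (suc i) (suc i))
    U = ∑ℤ (λ i → ∑ℤ (λ j → upper g (suc i) (suc j)))
    shuffle : ∀ d r D U → (d + r) + (r + (D + + 2 * U)) ≡ (d + D) + + 2 * ((+ 0 + r) + U)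
    shuffle = solve-∀

  spin² : ∀ b → spin b * spin b ≡ + 1
  spin² true  = refl
  spin² false = refl

  -- `H` computes its pair terms with a function local to its definition; unification recovers it here.
  pairTerm : ∀ {N} → Ising N → Assignment N → Fin N → Fin N → ℤ
  pairTerm I S = summand (Σℤ (λ i → Ising.h I i * spin (lookup S i))) (refl {x = H I S})
    where
    summand : ∀ {N} x {y} {p : Fin N → Fin N → ℤ} → x + Σℤ (λ i → Σℤ (p i)) ≡ y → Fin N → Fin N → ℤ
    summand x {p = p} _ = p

  module _ {N} (I : Ising N) (S : Assignment N) where
    open Ising I

    pairTerm-upper : ∀ i j →
      pairTerm I S i j ≡ upper (λ i j → J i j * spin (lookup S i) * spin (lookup S j)) i j
    pairTerm-upper i j with toℕ i ℕ.<? toℕ j in eq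
    -- The Boolean part of `_<?_` is definitionally the test `_<ᵇ_` in `upper`, so the recorded
    -- equation decides the conditional.
    ... | yes _ rewrite cong does eq = refl
    ... | no _  rewrite cong does eq = refl

    H-upper : H I S ≡ ∑ℤ (λ i → h i * spin (lookup S i))
                    + ∑ℤ (λ i → ∑ℤ (upper (λ i j → J i j * spin (lookup S i) * spin (lookup S j)) i))
    H-upper = cong₂ _+_ (Σℤ≡∑ℤ (λ i → h i * spin (lookup S i)))
      (trans (Σℤ≡∑ℤ (λ i → Σℤ (pairTerm I S i)))
        (∑ℤ-cong {f = λ i → Σℤ (pairTerm I S i)}
          (λ i → trans (Σℤ≡∑ℤ (pairTerm I S i)) (∑ℤ-cong {f = pairTerm I S i} (pairTerm-upper i)))))

  load : ∀ {N} → (Fin N → ℤ) → Assignment N → ℤ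
  load r S = ∑ℤ λ i → r i * spin (lookup S i)

  coupling : ∀ {n N} → (Fin n → Fin N → ℤ) → Fin N → Fin N → ℤ
  coupling a i j = ∑ℤ λ L → a L i * a L j

  module _ {n N} (a : Fin n → Fin N → ℤ) (t : Fin n → ℤ) where

    energy : Assignment N → ℤ
    energy S = ∑ℤ λ L → (load (a L) S - t L) * (load (a L) S - t L)

    -- This is half of the energy up to a constant: the cross terms `−2 t s` and the two orders of
    -- each pair both carry a factor 2, so halving keeps fields and couplings integral.
    ising : Ising N
    ising = record
      { h    = λ i → ∑ℤ λ L → - t L * a L i
      ; J    = coupling a
      ; Jsym = λ i j → ∑ℤ-cong λ L → ℤP.*-comm (a L i) (a L j)
      }

    open Ising ising

    -- Each square is expanded over pairs of variables; summing over the lines first then collects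
    -- the incidences into `coupling a`.
    ∑ℤ-load² : ∀ S → ∑ℤ (λ L → load (a L) S * load (a L) S) ≡
      ∑ℤ (λ i → ∑ℤ λ j → J i j * spin (lookup S i) * spin (lookup S j))
    ∑ℤ-load² S = begin
      ∑ℤ (λ L → load (a L) S * load (a L) S)
        ≡⟨ ∑ℤ-cong (λ L → trans (∑ℤ-*ʳ (load (a L) S) (λ i → a L i * σ i))
             (∑ℤ-cong λ i → ∑ℤ-*ˡ (a L i * σ i) (λ j → a L j * σ j))) ⟩
      ∑ℤ (λ L → ∑ℤ λ i → ∑ℤ λ j → (a L i * σ i) * (a L j * σ j))
        ≡⟨ ∑ℤ-swap (λ L i → ∑ℤ λ j → (a L i * σ i) * (a L j * σ j)) ⟩
      ∑ℤ (λ i → ∑ℤ λ L → ∑ℤ λ j → (a L i * σ i) * (a L j * σ j))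
        ≡⟨ ∑ℤ-cong (λ i → ∑ℤ-swap (λ L j → (a L i * σ i) * (a L j * σ j))) ⟩
      ∑ℤ (λ i → ∑ℤ λ j → ∑ℤ λ L → (a L i * σ i) * (a L j * σ j))
        ≡⟨ ∑ℤ-cong (λ i → ∑ℤ-cong λ j → trans
             (∑ℤ-cong (λ L → regroup (a L i) (σ i) (a L j) (σ j)))
             (sym (trans (cong (λ x → x * σ j) (∑ℤ-*ʳ (σ i) (λ L → a L i * a L j)))
                         (∑ℤ-*ʳ (σ j) (λ L → a L i * a L j * σ i))))) ⟩
      ∑ℤ (λ i → ∑ℤ λ j → J i j * σ i * σ j) ∎
      where
      open ≡-Reasoning
      σ = λ i → spin (lookup S i)
      regroup : ∀ x y z w → (x * y) * (z * w) ≡ x * z * y * w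
      regroup = solve-∀

    ∑ℤ-fields : ∀ S → ∑ℤ (λ i → h i * spin (lookup S i)) ≡ ∑ℤ (λ L → - t L * load (a L) S)
    ∑ℤ-fields S = begin
      ∑ℤ (λ i → h i * σ i)                      ≡⟨ ∑ℤ-cong (λ i → ∑ℤ-*ʳ (σ i) (λ L → - t L * a L i)) ⟩
      ∑ℤ (λ i → ∑ℤ λ L → - t L * a L i * σ i)    ≡⟨ ∑ℤ-swap (λ i L → - t L * a L i * σ i) ⟩
      ∑ℤ (λ L → ∑ℤ λ i → - t L * a L i * σ i)    ≡⟨ ∑ℤ-cong (λ L → trans
                                                     (∑ℤ-cong λ i → ℤP.*-assoc (- t L) (a L i) (σ i))
                                                     (sym (∑ℤ-*ˡ (- t L) (λ i → a L i * σ i)))) ⟩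
      ∑ℤ (λ L → - t L * load (a L) S)               ∎
      where
      open ≡-Reasoning
      σ = λ i → spin (lookup S i)

    -- These terms do not depend on the spins: the diagonal of the quadratic form is constant
    -- because squared spins are 1.
    offset : ℤ
    offset = ∑ℤ (λ i → J i i) + ∑ℤ (λ L → t L * t L)

    energy-H : ∀ S → energy S ≡ offset + + 2 * H ising S
    energy-H S = begin
      energy S
        ≡⟨ ∑ℤ-cong (λ L → square (load (a L) S) (t L)) ⟩
      ∑ℤ (λ L → load (a L) S * load (a L) S + (t L * t L + + 2 * (- t L * load (a L) S)))
        ≡⟨ ∑ℤ-+ (λ L → load (a L) S * load (a L) S) _ ⟩
      ∑ℤ (λ L → load (a L) S * load (a L) S) + ∑ℤ (λ L → t L * t L + + 2 * (- t L * load (a L) S))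
        ≡⟨ cong₂ _+_ (trans (∑ℤ-load² S) (∑ℤ-symmetric g g-sym)) (∑ℤ-+ (λ L → t L * t L) _) ⟩
      (∑ℤ (λ i → g i i) + + 2 * U) + (T + ∑ℤ (λ L → + 2 * (- t L * load (a L) S)))
        ≡⟨ cong₂ (λ x y → (x + + 2 * U) + (T + y)) (∑ℤ-cong diagonal)
             (trans (sym (∑ℤ-*ˡ (+ 2) (λ L → - t L * load (a L) S))) (cong (λ x → + 2 * x) (sym (∑ℤ-fields S)))) ⟩
      (D + + 2 * U) + (T + + 2 * F)
        ≡⟨ collect D U T F ⟩
      (D + T) + + 2 * (F + U)
        ≡⟨ cong (λ x → (D + T) + + 2 * x) (sym (H-upper ising S)) ⟩
      offset + + 2 * H ising S ∎
      where
      open ≡-Reasoning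
      σ = λ i → spin (lookup S i)
      g = λ i j → J i j * σ i * σ j
      D = ∑ℤ (λ i → J i i)
      T = ∑ℤ (λ L → t L * t L)
      F = ∑ℤ (λ i → h i * σ i)
      U = ∑ℤ (λ i → ∑ℤ (upper g i))
      square : ∀ x y → (x - y) * (x - y) ≡ x * x + (y * y + + 2 * (- y * x))
      square = solve-∀
      collect : ∀ D U T F → (D + + 2 * U) + (T + + 2 * F) ≡ (D + T) + + 2 * (F + U)
      collect = solve-∀
      swap-last : ∀ x y z → x * y * z ≡ x * z * y
      swap-last = solve-∀
      g-sym : ∀ i j → g i j ≡ g j i
      g-sym i j = trans (cong (λ x → x * σ i * σ j) (Jsym i j)) (swap-last (J j i) (σ i) (σ j))
      diagonal : ∀ i → g i i ≡ J i i
      diagonal i = trans (ℤP.*-assoc (J i i) (σ i) (σ i))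
        (trans (cong (λ x → J i i * x) (spin² (lookup S i))) (ℤP.*-identityʳ (J i i)))

    energy-cancel-≤ : ∀ {A B} → energy A ℤ.≤ energy B → H ising A ℤ.≤ H ising B
    energy-cancel-≤ {A} {B} le = ℤP.*-cancelˡ-≤-pos _ _ (+ 2)
      (subst₂ ℤ._≤_ (cancel (energy-H A)) (cancel (energy-H B)) (ℤP.+-monoʳ-≤ (- offset) le))
      where
      cancel-neg : ∀ x y → - x + (x + y) ≡ y
      cancel-neg = solve-∀
      cancel : ∀ {x y} → x ≡ offset + y → - offset + x ≡ y
      cancel eq = trans (cong (λ x → - offset + x) eq) (cancel-neg offset _)

    energy-mono-≤ : ∀ {A B} → H ising A ℤ.≤ H ising B → energy A ℤ.≤ energy B
    energy-mono-≤ {A} {B} le = subst₂ ℤ._≤_ (sym (energy-H A)) (sym (energy-H B))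
      (ℤP.+-monoʳ-≤ offset (ℤP.*-monoˡ-≤-nonNeg (+ 2) le))

  square-nonneg : ∀ i → + 0 ℤ.≤ i * i
  square-nonneg (+ n)        rewrite sym (ℤP.pos-* n n) = ℤ.+≤+ ℕ.z≤n
  square-nonneg (ℤ.-[1+ n ]) = ℤ.+≤+ ℕ.z≤n

  ∑ℤ-nonneg : ∀ {n} (g : Fin n → ℤ) → (∀ i → + 0 ℤ.≤ g i) → + 0 ℤ.≤ ∑ℤ g
  ∑ℤ-nonneg {zero}  g 0≤g = ℤP.≤-refl
  ∑ℤ-nonneg {suc n} g 0≤g = ℤP.+-mono-≤ (0≤g zero) (∑ℤ-nonneg (g ∘ suc) (0≤g ∘ suc))

  ∑ℤ-nonpos⇒zero : ∀ {n} (g : Fin n → ℤ) → (∀ i → + 0 ℤ.≤ g i) → ∑ℤ g ℤ.≤ + 0 → ∀ i → g i ≡ + 0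
  ∑ℤ-nonpos⇒zero {suc n} g 0≤g ∑ℤ≤0 zero = ℤP.≤-antisym
    (ℤP.≤-trans (subst (ℤ._≤ ∑ℤ g) (ℤP.+-identityʳ (g zero)) (ℤP.+-monoʳ-≤ (g zero) (∑ℤ-nonneg (g ∘ suc) (0≤g ∘ suc)))) ∑ℤ≤0)
    (0≤g zero)
  ∑ℤ-nonpos⇒zero {suc n} g 0≤g ∑ℤ≤0 (suc i) = ∑ℤ-nonpos⇒zero (g ∘ suc) (0≤g ∘ suc)
    (ℤP.≤-trans (subst (ℤ._≤ ∑ℤ g) (ℤP.+-identityˡ (∑ℤ (g ∘ suc))) (ℤP.+-monoˡ-≤ (∑ℤ (g ∘ suc)) (0≤g zero))) ∑ℤ≤0) i

  module _ {n N} (a : Fin n → Fin N → ℤ) (t : Fin n → ℤ) where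

    Balanced : Assignment N → Set
    Balanced S = ∀ L → load (a L) S ≡ t L

    energy-nonneg : ∀ S → + 0 ℤ.≤ energy a t S
    energy-nonneg S = ∑ℤ-nonneg _ λ L → square-nonneg (load (a L) S - t L)

    balanced⇒energy≡0 : ∀ {S} → Balanced S → energy a t S ≡ + 0
    balanced⇒energy≡0 {S} bal = trans (∑ℤ-cong λ L →
      cong (λ x → x * x) (trans (cong (λ x → x - t L) (bal L)) (ℤP.+-inverseʳ (t L)))) (∑ℤ-zero n)

    energy≤0⇒balanced : ∀ {S} → energy a t S ℤ.≤ + 0 → Balanced S
    energy≤0⇒balanced {S} le L = ℤP.i-j≡0⇒i≡j _ _ (root (∑ℤ-nonpos⇒zero _ (λ L → square-nonneg (load (a L) S - t L)) le L))
      where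
      root : ∀ {i} → i * i ≡ + 0 → i ≡ + 0
      root {i} eq with ℤP.i*j≡0⇒i≡0∨j≡0 i eq
      ... | inj₁ p = p
      ... | inj₂ p = p

    balanced⇒globalMin : ∀ {S} → Balanced S → GlobalMin (ising a t) S
    balanced⇒globalMin {S} bal B = energy-cancel-≤ a t
      (subst (ℤ._≤ energy a t B) (sym (balanced⇒energy≡0 {S} bal)) (energy-nonneg B))

    module _ {S₀} (bal₀ : Balanced S₀) where

      -- Comparison with `S₀` bounds the minimal energy by zero, and a sum of squares that is at
      -- most zero has only zero terms.
      globalMin⇒balanced : ∀ {A} → GlobalMin (ising a t) A → Balanced A
      globalMin⇒balanced {A} min = energy≤0⇒balanced {A}
        (subst (energy a t A ℤ.≤_) (balanced⇒energy≡0 {S₀} bal₀) (energy-mono-≤ a t (min S₀)))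

      -- If the two values agreed, `B` would be a global minimum as well, hence balanced.
      unbalanced⇒above-globalMin : ∀ {A B} → GlobalMin (ising a t) A → ¬ Balanced B → H (ising a t) A ℤ.< H (ising a t) B
      unbalanced⇒above-globalMin {A} {B} min ¬bal = ℤP.≤∧≢⇒< (min B) λ eq →
        ¬bal (globalMin⇒balanced {B} λ C → subst (ℤ._≤ H (ising a t) C) eq (min C))

open Hamiltonian
open import Data.Nat using (_+_; _*_; _^_; _∸_; _/_)

private variable
  A B : Set

-- Finite sums over indices and over lists.

∑-mono : ∀ {n} (f g : Fin n → ℕ) → (∀ i → f i ≤ g i) → ∑ f ≤ ∑ g
∑-mono {zero}  f g f≤g = z≤n
∑-mono {suc n} f g f≤g = ℕP.+-mono-≤ (f≤g zero) (∑-mono (f ∘ suc) (g ∘ suc) (f≤g ∘ suc))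

∑-const : ∀ n x → ∑ {n} (λ _ → x) ≡ n * x
∑-const zero    x = refl
∑-const (suc n) x = cong (λ y → x + y) (∑-const n x)

total : List A → (A → ℕ) → ℕ
total X f = sum (map f X)

total-mono : ∀ (X : List A) {f g} → (∀ x → f x ≤ g x) → total X f ≤ total X g
total-mono []      f≤g = z≤n
total-mono (x ∷ X) f≤g = ℕP.+-mono-≤ (f≤g x) (total-mono X f≤g)

total-cong : ∀ (X : List A) {f g} → (∀ x → f x ≡ g x) → total X f ≡ total X g
total-cong []      f≗g = refl
total-cong (x ∷ X) f≗g = cong₂ _+_ (f≗g x) (total-cong X f≗g)

total-+ : ∀ (X : List A) f g → total X (λ x → f x + g x) ≡ total X f + total X g
total-+ []      f g = refl
total-+ (x ∷ X) f g = trans (cong (λ y → f x + g x + y) (total-+ X f g)) (interchange (f x) (g x) (total X f) (total X g))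
  where
  interchange : ∀ a b c d → a + b + (c + d) ≡ a + c + (b + d)
  interchange = ℕ-solve-∀

total-* : ∀ (X : List A) c f → total X (λ x → c * f x) ≡ c * total X f
total-* []      c f = sym (ℕP.*-zeroʳ c)
total-* (x ∷ X) c f = trans (cong (λ y → c * f x + y) (total-* X c f)) (sym (ℕP.*-distribˡ-+ c (f x) (total X f)))

total-const : ∀ (X : List A) c → total X (λ _ → c) ≡ length X * c
total-const []      c = refl
total-const (x ∷ X) c = cong (λ y → c + y) (total-const X c)

total-swap : ∀ (X : List A) (Y : List B) (f : A → B → ℕ) →
  total X (λ x → total Y (f x)) ≡ total Y (λ y → total X (λ x → f x y))
total-swap []      Y f = sym (trans (total-const Y 0) (ℕP.*-zeroʳ (length Y)))
total-swap (x ∷ X) Y f = trans (cong (λ y → total Y (f x) + y) (total-swap X Y f)) (sym (total-+ Y (f x) (λ y → total X (λ x → f x y))))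

total-∑ : ∀ {n} (X : List A) (f : A → Fin n → ℕ) →
  total X (λ x → ∑ (f x)) ≡ ∑ (λ i → total X (λ x → f x i))
total-∑ {n = zero}  X f = trans (total-const X 0) (ℕP.*-zeroʳ (length X))
total-∑ {n = suc n} X f = trans (total-+ X (λ x → f x zero) (λ x → ∑ (f x ∘ suc)))
  (cong (λ y → total X (λ x → f x zero) + y) (total-∑ X (λ x → f x ∘ suc)))

total-∈ : ∀ {X : List A} {x} f → x ∈ X → f x ≤ total X f
total-∈ f (here refl) = ℕP.m≤m+n _ _
total-∈ {X = y ∷ _} f (there x∈X) = ℕP.≤-trans (total-∈ f x∈X) (ℕP.m≤n+m _ (f y))

total-++ : ∀ (X Y : List A) f → total (X ++ Y) f ≡ total X f + total Y f
total-++ X Y f = trans (cong sum (map-++ f X Y)) (sum-++ (map f X) (map f Y))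

total-map : ∀ (h : A → B) X f → total (map h X) f ≡ total X (f ∘ h)
total-map h X f = cong sum (sym (map-∘ X))

total-filter : ∀ {p} {P : Pred A p} (P? : Decidable P) (X : List A) f →
  total (filter P? X) f ≡ total X (λ x → if does (P? x) then f x else 0)
total-filter P? []      f = refl
total-filter P? (x ∷ X) f with does (P? x)
... | true  = cong (λ y → f x + y) (total-filter P? X f)
... | false = total-filter P? X f

-- The weighted pigeonhole principle.

total-≤-max : ∀ (V : List A) (w r : A → ℕ) → A → ∃ λ v → total V (λ u → w u * r u) ≤ total V w * r v
total-≤-max []      w r v₀ = v₀ , z≤n
-- The witness is a running maximiser of `r`; the spare element `v₀` is its initial candidate, so
-- the empty list needs no exception.
total-≤-max (u ∷ V) w r v₀ with total-≤-max V w r v₀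
... | v , le with ℕP.≤-total (r u) (r v)
... | inj₁ ru≤rv = v , ℕP.≤-trans (ℕP.+-mono-≤ (ℕP.*-monoʳ-≤ (w u) ru≤rv) le)
                         (ℕP.≤-reflexive (sym (ℕP.*-distribʳ-+ (r v) (w u) (total V w))))
... | inj₂ rv≤ru = u , ℕP.≤-trans (ℕP.+-monoʳ-≤ (w u * r u) (ℕP.≤-trans le (ℕP.*-monoʳ-≤ (total V w) rv≤ru)))
                         (ℕP.≤-reflexive (sym (ℕP.*-distribʳ-+ (r u) (w u) (total V w))))

module _ (V : List ℤ) (w : ℤ → ℕ) where

  -- Grouping the elements of `X` by their value under `φ` gives a sum over values `v` of `w v`
  -- times the mass of the fibre, and `total-≤-max` selects the heaviest fibre.
  weighted-fibre : ∀ (X : List A) (φ : A → ℤ) (R : A → ℕ) → (∀ x → φ x ∈ V) →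
    ∃ λ v → total X (λ x → w (φ x) * R x) ≤ total V w * total (filter (λ x → φ x ℤ.≟ v) X) R
  weighted-fibre X φ R φ∈V with total-≤-max V w (λ v → total (filter (λ x → φ x ℤ.≟ v) X) R) (+ 0)
  ... | v , le = v , ℕP.≤-trans bound le
    where
    χ : ℤ → _ → ℕ
    χ v x = if does (φ x ℤ.≟ v) then R x else 0
    χ-diag : ∀ x → χ (φ x) x ≡ R x
    χ-diag x with φ x ℤ.≟ φ x
    ... | yes _ = refl
    ... | no ≢  = contradiction refl ≢
    open ℕP.≤-Reasoning
    bound : total X (λ x → w (φ x) * R x) ≤ total V (λ v → w v * total (filter (λ x → φ x ℤ.≟ v) X) R)
    bound = begin
      total X (λ x → w (φ x) * R x)
        ≡⟨ total-cong X (λ x → cong (w (φ x) *_) (sym (χ-diag x))) ⟩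
      total X (λ x → w (φ x) * χ (φ x) x)
        -- Only membership in `V` enters, so a value that `V` lists twice merely enlarges the right
        -- side.
        ≤⟨ total-mono X (λ x → total-∈ (λ v → w v * χ v x) (φ∈V x)) ⟩
      total X (λ x → total V (λ v → w v * χ v x))
        ≡⟨ total-swap X V (λ x v → w v * χ v x) ⟩
      total V (λ v → total X (λ x → w v * χ v x))
        ≡⟨ total-cong V (λ v → trans (total-* X (w v) (χ v))
             (cong (w v *_) (sym (total-filter (λ x → φ x ℤ.≟ v) X R)))) ⟩
      total V (λ v → w v * total (filter (λ x → φ x ℤ.≟ v) X) R) ∎

  -- The targets are fixed line by line. The product of the weights on the remaining lines is the
  -- mass to preserve while the first value is chosen, and each choice costs one factor `total V w`.
  weighted-pigeonhole : ∀ n (s : Fin n → A → ℤ) (X : List A) → (∀ L x → s L x ∈ V) →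
    ∃₂ λ (t : Fin n → ℤ) Y → (Unique X → Unique Y) × (∀ {x} → x ∈ Y → x ∈ X × (∀ L → s L x ≡ t L))
      × total X (λ x → ∏ (λ L → w (s L x))) ≤ total V w ^ n * length Y
  weighted-pigeonhole zero    s X s∈V = (λ ()) , X , id , (λ x∈X → x∈X , λ ())
    , ℕP.≤-reflexive (trans (total-const X 1) (trans (ℕP.*-identityʳ _) (sym (ℕP.*-identityˡ _))))
  weighted-pigeonhole (suc n) s X s∈V
    with weighted-fibre X (s zero) (λ x → ∏ (λ L → w (s (suc L) x))) (s∈V zero)
  ... | v , le with weighted-pigeonhole n (s ∘ suc) (filter (λ x → s zero x ℤ.≟ v) X) (s∈V ∘ suc)
  ... | t , Y , uniq , Y⊆ , le′ = v Vector.∷ t , Y , uniq ∘ Unique.filter⁺ (λ x → s zero x ℤ.≟ v) , fibre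
    , ℕP.≤-trans le (ℕP.≤-trans (ℕP.*-monoʳ-≤ (total V w) le′) (ℕP.≤-reflexive (sym (ℕP.*-assoc (total V w) _ _))))
    where
    fibre : ∀ {x} → x ∈ Y → x ∈ X × (∀ L → s L x ≡ (v Vector.∷ t) L)
    fibre x∈Y with Y⊆ x∈Y
    ... | x∈ , eqs with ∈-filter⁻ (λ x → s zero x ℤ.≟ v) {xs = X} x∈
    ... | x∈X , eq = x∈X , λ { zero → eq ; (suc L) → eqs L }

-- The second moment and the range of a load.

assignments : ∀ N → List (Assignment N)
assignments zero    = Vec.[] ∷ []
assignments (suc N) = map (true Vec.∷_) (assignments N) ++ map (false Vec.∷_) (assignments N)

length-assignments : ∀ N → length (assignments N) ≡ 2 ^ N
length-assignments zero    = refl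
length-assignments (suc N) = trans (length-++ (map (true Vec.∷_) (assignments N)))
  (cong₂ _+_ (trans (length-map _ (assignments N)) (length-assignments N))
             (trans (trans (length-map _ (assignments N)) (length-assignments N)) (sym (ℕP.+-identityʳ _))))

assignments-unique : ∀ N → Unique (assignments N)
assignments-unique zero    = [] ∷ []
assignments-unique (suc N) = Unique.++⁺ (Unique.map⁺ VecP.∷-injectiveʳ (assignments-unique N))
  (Unique.map⁺ VecP.∷-injectiveʳ (assignments-unique N)) disjoint
  where
  disjoint : ∀ {S} → ¬ (S ∈ map (true Vec.∷_) (assignments N) × S ∈ map (false Vec.∷_) (assignments N))
  disjoint (p , q) with ∈-map⁻ _ p | ∈-map⁻ _ q
  ... | _ , _ , refl | _ , _ , ()

+∣i∣²≡i² : ∀ i → + (∣ i ∣ * ∣ i ∣) ≡ i ℤ.* i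
+∣i∣²≡i² (+ n)        = ℤP.pos-* n n
+∣i∣²≡i² (ℤ.-[1+ n ]) = refl

-- Adding up both values of one spin cancels the cross term, which is how independence of the spins
-- enters the variance.
parallelogram : ∀ a x → ∣ a ℤ.* spin true ℤ.+ x ∣ * ∣ a ℤ.* spin true ℤ.+ x ∣ + ∣ a ℤ.* spin false ℤ.+ x ∣ * ∣ a ℤ.* spin false ℤ.+ x ∣
  ≡ 2 * (∣ a ∣ * ∣ a ∣) + 2 * (∣ x ∣ * ∣ x ∣)
parallelogram a x = ℤP.+-injective (begin
  + (∣ p ∣ * ∣ p ∣ + ∣ m ∣ * ∣ m ∣)                ≡⟨ cong₂ ℤ._+_ (+∣i∣²≡i² p) (+∣i∣²≡i² m) ⟩
  p ℤ.* p ℤ.+ m ℤ.* m                              ≡⟨ expand a x ⟩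
  + 2 ℤ.* (a ℤ.* a) ℤ.+ + 2 ℤ.* (x ℤ.* x)          ≡⟨ cong₂ (λ y z → + 2 ℤ.* y ℤ.+ + 2 ℤ.* z) (+∣i∣²≡i² a) (+∣i∣²≡i² x) ⟨
  + 2 ℤ.* + (∣ a ∣ * ∣ a ∣) ℤ.+ + 2 ℤ.* + (∣ x ∣ * ∣ x ∣) ≡⟨ cong₂ ℤ._+_ (ℤP.pos-* 2 (∣ a ∣ * ∣ a ∣)) (ℤP.pos-* 2 (∣ x ∣ * ∣ x ∣)) ⟨
  + (2 * (∣ a ∣ * ∣ a ∣) + 2 * (∣ x ∣ * ∣ x ∣))    ∎)
  where
  open ≡-Reasoning
  p = a ℤ.* spin true ℤ.+ x
  m = a ℤ.* spin false ℤ.+ x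
  expand : ∀ a x → (a ℤ.* + 1 ℤ.+ x) ℤ.* (a ℤ.* + 1 ℤ.+ x) ℤ.+ (a ℤ.* - (+ 1) ℤ.+ x) ℤ.* (a ℤ.* - (+ 1) ℤ.+ x)
    ≡ + 2 ℤ.* (a ℤ.* a) ℤ.+ + 2 ℤ.* (x ℤ.* x)
  expand = solve-∀

-- Under the uniform distribution the spins are independent with mean 0 and variance 1, so variances
-- add; `2 ^ N` removes the normalisation.
second-moment : ∀ N (r : Fin N → ℤ) →
  total (assignments N) (λ S → ∣ load r S ∣ * ∣ load r S ∣) ≡ 2 ^ N * ∑ (λ i → ∣ r i ∣ * ∣ r i ∣)
second-moment zero    r = refl
second-moment (suc N) r = begin
  total (map (true Vec.∷_) 𝒜 ++ map (false Vec.∷_) 𝒜) q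
    ≡⟨ total-++ (map (true Vec.∷_) 𝒜) _ q ⟩
  total (map (true Vec.∷_) 𝒜) q + total (map (false Vec.∷_) 𝒜) q
    ≡⟨ cong₂ _+_ (total-map (true Vec.∷_) 𝒜 q) (total-map (false Vec.∷_) 𝒜 q) ⟩
  total 𝒜 (q ∘ (true Vec.∷_)) + total 𝒜 (q ∘ (false Vec.∷_))
    ≡⟨ total-+ 𝒜 (q ∘ (true Vec.∷_)) (q ∘ (false Vec.∷_)) ⟨
  total 𝒜 (λ S → q (true Vec.∷ S) + q (false Vec.∷ S))
    ≡⟨ total-cong 𝒜 (λ S → parallelogram (r zero) (load (r ∘ suc) S)) ⟩
  total 𝒜 (λ S → 2 * (∣ r zero ∣ * ∣ r zero ∣) + 2 * q′ S)
    ≡⟨ total-+ 𝒜 (λ _ → 2 * (∣ r zero ∣ * ∣ r zero ∣)) (λ S → 2 * q′ S) ⟩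
  total 𝒜 (λ _ → 2 * (∣ r zero ∣ * ∣ r zero ∣)) + total 𝒜 (λ S → 2 * q′ S)
    ≡⟨ cong₂ _+_ (trans (total-const 𝒜 _) (cong (_* (2 * (∣ r zero ∣ * ∣ r zero ∣))) (length-assignments N)))
                 (trans (total-* 𝒜 2 q′) (cong (2 *_) (second-moment N (r ∘ suc)))) ⟩
  2 ^ N * (2 * (∣ r zero ∣ * ∣ r zero ∣)) + 2 * (2 ^ N * ∑ (λ i → ∣ r (suc i) ∣ * ∣ r (suc i) ∣))
    ≡⟨ factor (2 ^ N) (∣ r zero ∣ * ∣ r zero ∣) _ ⟩
  2 * 2 ^ N * (∣ r zero ∣ * ∣ r zero ∣ + ∑ (λ i → ∣ r (suc i) ∣ * ∣ r (suc i) ∣)) ∎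
  where
  open ≡-Reasoning
  𝒜 = assignments N
  q = λ S → ∣ load r S ∣ * ∣ load r S ∣
  q′ = λ S → ∣ load (r ∘ suc) S ∣ * ∣ load (r ∘ suc) S ∣
  factor : ∀ a b c → a * (2 * b) + 2 * (a * c) ≡ 2 * a * (b + c)
  factor = ℕ-solve-∀

m≤m*m : ∀ m → m ≤ m * m
m≤m*m zero    = z≤n
m≤m*m (suc m) = ℕP.m≤m+n (suc m) _

-- An integer is at most its square in absolute value, so the squared row norm that gives the
-- variance also bounds the range.
∣load∣≤ : ∀ {N} (r : Fin N → ℤ) S → ∣ load r S ∣ ≤ ∑ (λ i → ∣ r i ∣ * ∣ r i ∣)
∣load∣≤ {zero}  r S = z≤n
∣load∣≤ {suc N} r (b Vec.∷ S) = begin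
  ∣ r zero ℤ.* spin b ℤ.+ load (r ∘ suc) S ∣           ≤⟨ ℤP.∣i+j∣≤∣i∣+∣j∣ (r zero ℤ.* spin b) _ ⟩
  ∣ r zero ℤ.* spin b ∣ + ∣ load (r ∘ suc) S ∣         ≤⟨ ℕP.+-mono-≤ first (∣load∣≤ (r ∘ suc) S) ⟩
  ∣ r zero ∣ * ∣ r zero ∣ + ∑ (λ i → ∣ r (suc i) ∣ * ∣ r (suc i) ∣) ∎
  where
  open ℕP.≤-Reasoning
  ∣spin∣ : ∀ b → ∣ spin b ∣ ≡ 1
  ∣spin∣ true  = refl
  ∣spin∣ false = refl
  first : ∣ r zero ℤ.* spin b ∣ ≤ ∣ r zero ∣ * ∣ r zero ∣
  first = begin
    ∣ r zero ℤ.* spin b ∣     ≡⟨ ℤP.abs-* (r zero) (spin b) ⟩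
    ∣ r zero ∣ * ∣ spin b ∣   ≡⟨ cong (∣ r zero ∣ *_) (∣spin∣ b) ⟩
    ∣ r zero ∣ * 1            ≡⟨ ℕP.*-identityʳ _ ⟩
    ∣ r zero ∣                ≤⟨ m≤m*m ∣ r zero ∣ ⟩
    ∣ r zero ∣ * ∣ r zero ∣   ∎

-- Geometric weights on the possible loads.

interval : ℕ → List ℤ
interval l = map +_ (upTo (suc l)) ++ map (λ u → - (+ u)) (upTo (suc l))

∈-interval : ∀ {l} i → ∣ i ∣ ≤ l → i ∈ interval l
∈-interval     (+ n)        ≤l = ∈-++⁺ˡ (∈-map⁺ +_ (∈-upTo⁺ (s≤s ≤l)))
∈-interval {l} (ℤ.-[1+ n ]) ≤l = ∈-++⁺ʳ (map +_ (upTo (suc l))) (∈-map⁺ (λ u → - (+ u)) (∈-upTo⁺ (s≤s ≤l)))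

sum-applyUpTo-≤ : ∀ (g : ℕ → ℕ) n c → (∀ u → g u ≤ c) → sum (applyUpTo g n) ≤ n * c
sum-applyUpTo-≤ g zero    c g≤c = z≤n
sum-applyUpTo-≤ g (suc n) c g≤c = ℕP.+-mono-≤ (g≤c 0) (sum-applyUpTo-≤ (g ∘ suc) n c (g≤c ∘ suc))

sum-applyUpTo-+ : ∀ (g : ℕ → ℕ) m n →
  sum (applyUpTo g (m + n)) ≡ sum (applyUpTo g m) + sum (applyUpTo (λ u → g (m + u)) n)
sum-applyUpTo-+ g zero    n = refl
sum-applyUpTo-+ g (suc m) n = trans (cong (λ y → g 0 + y) (sum-applyUpTo-+ (g ∘ suc) m n)) (sym (ℕP.+-assoc (g 0) _ _))

sum-applyUpTo-cong : ∀ {g g′ : ℕ → ℕ} n → (∀ u → g u ≡ g′ u) → sum (applyUpTo g n) ≡ sum (applyUpTo g′ n)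
sum-applyUpTo-cong zero    eq = refl
sum-applyUpTo-cong (suc n) eq = cong₂ _+_ (eq 0) (sum-applyUpTo-cong n (eq ∘ suc))

module Weights (q : ℕ) .{{_ : NonZero q}} where

  -- This is the weight 2^-⌊u/q⌋ scaled by `2 ^ l` to stay a natural number; for `u ≤ l` the
  -- truncated subtraction is exact.
  geometric : ℕ → ℕ → ℕ
  geometric l u = 2 ^ (l ∸ u / q)

  geometric≤ : ∀ l u → geometric l u ≤ 2 ^ l
  geometric≤ l u = ℕP.^-monoʳ-≤ 2 (ℕP.m∸n≤m l (u / q))

  geometric-shift : ∀ l u → geometric (suc l) (q + u) ≡ geometric l u
  geometric-shift l u = cong (λ e → 2 ^ (suc l ∸ e))
    (trans (+-distrib-/-∣ˡ u ∣-refl) (cong (_+ u / q) (n/n≡1 q)))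

  -- Blocks of `q` consecutive arguments have equal weight and each block weighs half as much as the
  -- previous one. The bound on `n` stops the sum before truncation would spoil the halving.
  sum-geometric : ∀ l n → n ≤ suc l * q → sum (applyUpTo (geometric l) n) ≤ 2 * (q * 2 ^ l)
  sum-geometric l n n≤ with ℕP.≤-total n q
  ... | inj₁ n≤q = ℕP.≤-trans (sum-applyUpTo-≤ (geometric l) n (2 ^ l) (geometric≤ l))
                    (ℕP.≤-trans (ℕP.*-monoˡ-≤ (2 ^ l) n≤q) (ℕP.m≤m+n _ _))
  sum-geometric zero n n≤ | inj₂ q≤n = ℕP.≤-trans (sum-applyUpTo-≤ (geometric 0) n 1 (geometric≤ 0))
    (ℕP.≤-trans (ℕP.*-monoˡ-≤ 1 (subst (n ≤_) (ℕP.+-identityʳ q) n≤)) (ℕP.m≤m+n _ _))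
  sum-geometric (suc l) n n≤ | inj₂ q≤n with ℕP.m≤n⇒∃[o]m+o≡n q≤n
  ... | m , refl = begin
    sum (applyUpTo (geometric (suc l)) (q + m))
      ≡⟨ sum-applyUpTo-+ (geometric (suc l)) q m ⟩
    sum (applyUpTo (geometric (suc l)) q) + sum (applyUpTo (λ u → geometric (suc l) (q + u)) m)
      ≡⟨ cong (λ y → sum (applyUpTo (geometric (suc l)) q) + y) (sum-applyUpTo-cong m (geometric-shift l)) ⟩
    sum (applyUpTo (geometric (suc l)) q) + sum (applyUpTo (geometric l) m)
      ≤⟨ ℕP.+-mono-≤ (sum-applyUpTo-≤ _ q _ (geometric≤ (suc l))) (sum-geometric l m (ℕP.+-cancelˡ-≤ q _ _ n≤)) ⟩
    q * (2 * 2 ^ l) + 2 * (q * 2 ^ l)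
      ≡⟨ collect q (2 ^ l) ⟩
    2 * (q * (2 * 2 ^ l)) ∎
    where
    open ℕP.≤-Reasoning
    collect : ∀ q x → q * (2 * x) + 2 * (q * x) ≡ 2 * (q * (2 * x))
    collect = ℕ-solve-∀

  weight : ℕ → ℤ → ℕ
  weight l s = geometric l ∣ s ∣

  -- The nonnegative and the nonpositive half both contain zero and have equal sums, each at most
  -- `2 * (q * 2 ^ l)`.
  total-weight : ∀ l → total (interval l) (weight l) ≤ 4 * q * 2 ^ l
  total-weight l = begin
    total (interval l) (weight l)
      ≡⟨ total-++ (map +_ (upTo (suc l))) _ (weight l) ⟩
    total (map +_ (upTo (suc l))) (weight l) + total (map (λ u → - (+ u)) (upTo (suc l))) (weight l)
      ≡⟨ cong₂ _+_ (total-map +_ (upTo (suc l)) (weight l))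
           (trans (total-map (λ u → - (+ u)) (upTo (suc l)) (weight l))
             (total-cong (upTo (suc l)) λ u → cong (geometric l) (ℤP.∣-i∣≡∣i∣ (+ u)))) ⟩
    total (upTo (suc l)) (geometric l) + total (upTo (suc l)) (geometric l)
      ≡⟨ cong (λ y → y + y) (cong sum (map-upTo (geometric l) (suc l))) ⟩
    sum (applyUpTo (geometric l) (suc l)) + sum (applyUpTo (geometric l) (suc l))
      ≤⟨ ℕP.+-mono-≤ half half ⟩
    2 * (q * 2 ^ l) + 2 * (q * 2 ^ l)
      ≡⟨ collect q (2 ^ l) ⟩
    4 * q * 2 ^ l ∎
    where
    open ℕP.≤-Reasoning
    half : sum (applyUpTo (geometric l) (suc l)) ≤ 2 * (q * 2 ^ l)
    half = sum-geometric l (suc l) (ℕP.m≤m*n (suc l) q)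
    collect : ∀ q x → 2 * (q * x) + 2 * (q * x) ≡ 4 * q * x
    collect = ℕ-solve-∀

  -- Negative exponents are cleared factor by factor, and truncation only helps. The product of
  -- weights is thus bounded below through a single exponent, ready for `tangent`.
  ∏-geometric : ∀ l {n} (u : Fin n → ℕ) → 2 ^ (n * l) ≤ ∏ (λ L → geometric l (u L)) * 2 ^ ∑ (λ L → u L / q)
  ∏-geometric l {zero}  u = s≤s z≤n
  ∏-geometric l {suc n} u = begin
    2 ^ (l + n * l)              ≡⟨ ℕP.^-distribˡ-+-* 2 l (n * l) ⟩
    2 ^ l * 2 ^ (n * l)          ≤⟨ ℕP.*-mono-≤ (ℕP.^-monoʳ-≤ 2 (ℕP.m≤n+m∸n l e)) (∏-geometric l (u ∘ suc)) ⟩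
    2 ^ (e + (l ∸ e)) * (P * 2 ^ E) ≡⟨ cong (_* (P * 2 ^ E)) (ℕP.^-distribˡ-+-* 2 e (l ∸ e)) ⟩
    2 ^ e * G * (P * 2 ^ E)      ≡⟨ regroup (2 ^ e) G P (2 ^ E) ⟩
    G * P * (2 ^ e * 2 ^ E)      ≡⟨ cong (G * P *_) (ℕP.^-distribˡ-+-* 2 e E) ⟨
    G * P * 2 ^ (e + E)          ∎
    where
    open ℕP.≤-Reasoning
    e = u zero / q
    E = ∑ (λ L → u (suc L) / q)
    G = geometric l (u zero)
    P = ∏ (λ L → geometric l (u (suc L)))
    regroup : ∀ a b c d → a * b * (c * d) ≡ b * c * (a * d)
    regroup = ℕ-solve-∀

  -- The quotient is a natural number, hence at most its square; this lets the second moment control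
  -- a first moment.
  q²*[u/q]≤u² : ∀ u → q * q * (u / q) ≤ u * u
  q²*[u/q]≤u² u = begin
    q * q * (u / q)              ≤⟨ ℕP.*-monoʳ-≤ (q * q) (m≤m*m (u / q)) ⟩
    q * q * (u / q * (u / q))    ≡⟨ regroup q (u / q) ⟩
    (u / q * q) * (u / q * q)    ≤⟨ ℕP.*-mono-≤ (m/n*n≤m u q) (m/n*n≤m u q) ⟩
    u * u                        ∎
    where
    open ℕP.≤-Reasoning
    regroup : ∀ q e → q * q * (e * e) ≡ (e * q) * (e * q)
    regroup = ℕ-solve-∀

-- Jensen's inequality and a popular vector of loads.

suc≤2^ : ∀ d → suc d ≤ 2 ^ d
suc≤2^ zero    = ℕP.≤-refl
suc≤2^ (suc d) = ℕP.+-mono-≤ (ℕP.m^n>0 2 d) (subst (suc d ≤_) (sym (ℕP.+-identityʳ _)) (suc≤2^ d))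

-- The tangent line to the convex function m ↦ K 2^(n−m) at m = n.
tangent : ∀ K P n m → K ≤ P * 2 ^ m → K * suc n ≤ 2 ^ n * P + K * m
tangent K P n m K≤ with ℕP.≤-total m n
... | inj₂ n≤m with ℕP.m≤n⇒m<n∨m≡n n≤m
...   | inj₁ n<m  = ℕP.≤-trans (ℕP.*-monoʳ-≤ K n<m) (ℕP.m≤n+m _ _)
...   | inj₂ refl = ℕP.≤-trans (ℕP.≤-reflexive (ℕP.*-suc K n)) (ℕP.+-monoˡ-≤ (K * n) (subst (K ≤_) (ℕP.*-comm P (2 ^ n)) K≤))
tangent K P n m K≤ | inj₁ m≤n with ℕP.m≤n⇒∃[o]m+o≡n m≤n
... | d , refl = begin
  K * suc (m + d)                  ≡⟨ split K m d ⟩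
  suc d * K + K * m                ≤⟨ ℕP.+-monoˡ-≤ (K * m) (ℕP.*-mono-≤ (suc≤2^ d) K≤) ⟩
  2 ^ d * (P * 2 ^ m) + K * m      ≡⟨ cong (_+ K * m) (regroup (2 ^ d) P (2 ^ m)) ⟩
  2 ^ m * 2 ^ d * P + K * m        ≡⟨ cong (λ y → y * P + K * m) (ℕP.^-distribˡ-+-* 2 m d) ⟨
  2 ^ (m + d) * P + K * m          ∎
  where
  open ℕP.≤-Reasoning
  split : ∀ K m d → K * suc (m + d) ≡ suc d * K + K * m
  split = ℕ-solve-∀
  regroup : ∀ a b c → a * (b * c) ≡ c * a * b
  regroup = ℕ-solve-∀

^-distribʳ-* : ∀ a b n → (a * b) ^ n ≡ a ^ n * b ^ n
^-distribʳ-* a b zero    = refl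
^-distribʳ-* a b (suc n) = trans (cong (a * b *_) (^-distribʳ-* a b n)) (regroup a b (a ^ n) (b ^ n))
  where
  regroup : ∀ a b c d → a * b * (c * d) ≡ a * c * (b * d)
  regroup = ℕ-solve-∀

module _ {n N} (a : Fin n → Fin N → ℤ) (l q : ℕ) .{{q≢0 : NonZero q}}
         (row : ∀ L → ∑ (λ i → ∣ a L i ∣ * ∣ a L i ∣) ≡ l) (l≤q² : l ≤ q * q) where

  open Weights q

  private
    𝒜 = assignments N
    K = 2 ^ (n * l)
    W : Assignment N → ℕ
    W S = ∏ (λ L → weight l (load (a L) S))
    excess : Assignment N → ℕ
    excess S = ∑ (λ L → ∣ load (a L) S ∣ / q)

    -- On each line the mean of ⌊|s|/q⌋ is at most `l / q²`, hence at most 1.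
    total-excess : total 𝒜 excess ≤ n * length 𝒜
    total-excess = ℕP.*-cancelˡ-≤ (q * q) {{ℕP.m*n≢0 q q}} (begin
      q * q * total 𝒜 excess
        ≡⟨ total-* 𝒜 (q * q) excess ⟨
      total 𝒜 (λ S → q * q * excess S)
        ≤⟨ total-mono 𝒜 (λ S → ℕP.≤-trans
             (ℕP.≤-reflexive (∑-*ˡ (q * q) (λ L → ∣ load (a L) S ∣ / q)))
             (∑-mono _ _ λ L → q²*[u/q]≤u² ∣ load (a L) S ∣)) ⟩
      total 𝒜 (λ S → ∑ (λ L → ∣ load (a L) S ∣ * ∣ load (a L) S ∣))
        ≡⟨ total-∑ 𝒜 (λ S L → ∣ load (a L) S ∣ * ∣ load (a L) S ∣) ⟩
      ∑ (λ L → total 𝒜 (λ S → ∣ load (a L) S ∣ * ∣ load (a L) S ∣))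
        ≡⟨ ∑-cong (λ L → trans (second-moment N (a L)) (cong (2 ^ N *_) (row L))) ⟩
      ∑ {n} (λ L → 2 ^ N * l)
        ≡⟨ ∑-const n _ ⟩
      n * (2 ^ N * l)
        ≤⟨ ℕP.*-monoʳ-≤ n (ℕP.*-monoʳ-≤ (2 ^ N) l≤q²) ⟩
      n * (2 ^ N * (q * q))
        ≡⟨ trans (cong (λ y → n * (y * (q * q))) (sym (length-assignments N))) (regroup n (length 𝒜) (q * q)) ⟩
      q * q * (n * length 𝒜) ∎)
      where
      open ℕP.≤-Reasoning
      regroup : ∀ n x y → n * (x * y) ≡ y * (n * x)
      regroup = ℕ-solve-∀

    -- This is Jensen's inequality: `tangent` at the point `n` is summed over all assignments, and
    -- since the mean excess is at most `n`, the linear term can be cancelled.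
    total-W : K * length 𝒜 ≤ 2 ^ n * total 𝒜 W
    total-W = ℕP.+-cancelʳ-≤ (K * (n * length 𝒜)) _ _ (begin
      K * length 𝒜 + K * (n * length 𝒜)
        ≡⟨ split K n (length 𝒜) ⟩
      length 𝒜 * (K * suc n)
        ≡⟨ total-const 𝒜 (K * suc n) ⟨
      total 𝒜 (λ _ → K * suc n)
        ≤⟨ total-mono 𝒜 (λ S → tangent K (W S) n (excess S) (∏-geometric l (λ L → ∣ load (a L) S ∣))) ⟩
      total 𝒜 (λ S → 2 ^ n * W S + K * excess S)
        ≡⟨ trans (total-+ 𝒜 (λ S → 2 ^ n * W S) (λ S → K * excess S)) (cong₂ _+_ (total-* 𝒜 (2 ^ n) W) (total-* 𝒜 K excess)) ⟩
      2 ^ n * total 𝒜 W + K * total 𝒜 excess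
        ≤⟨ ℕP.+-monoʳ-≤ (2 ^ n * total 𝒜 W) (ℕP.*-monoʳ-≤ K total-excess) ⟩
      2 ^ n * total 𝒜 W + K * (n * length 𝒜) ∎)
      where
      open ℕP.≤-Reasoning
      split : ∀ K n x → K * x + K * (n * x) ≡ x * (K * suc n)
      split = ℕ-solve-∀

  -- Per line, the pigeonhole costs `4 * q * 2 ^ l` and Jensen costs 2, while the scaling `K`
  -- returns `2 ^ l`; this leaves `8 * q`.
  popular-load : ∃₂ λ (t : Fin n → ℤ) Y → Unique Y × (∀ {S} → S ∈ Y → ∀ L → load (a L) S ≡ t L)
    × 2 ^ N ≤ (8 * q) ^ n * length Y
  popular-load with weighted-pigeonhole (interval l) (weight l) n (λ L → load (a L)) 𝒜
    (λ L S → ∈-interval (load (a L) S) (subst (∣ load (a L) S ∣ ≤_) (row L) (∣load∣≤ (a L) S)))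
  ... | t , Y , uniq , Y⊆ , le = t , Y , uniq (assignments-unique N) , proj₂ ∘ Y⊆ ,
    ℕP.*-cancelˡ-≤ K {{ℕP.m^n≢0 2 (n * l)}} (begin
      K * 2 ^ N                                        ≡⟨ cong (K *_) (length-assignments N) ⟨
      K * length 𝒜                                     ≤⟨ total-W ⟩
      2 ^ n * total 𝒜 W                                ≤⟨ ℕP.*-monoʳ-≤ (2 ^ n) le ⟩
      2 ^ n * (total (interval l) (weight l) ^ n * M)  ≤⟨ ℕP.*-monoʳ-≤ (2 ^ n) (ℕP.*-monoˡ-≤ M (ℕP.^-monoˡ-≤ n (total-weight l))) ⟩
      2 ^ n * ((4 * q * 2 ^ l) ^ n * M)                ≡⟨ ℕP.*-assoc (2 ^ n) _ M ⟨
      2 ^ n * (4 * q * 2 ^ l) ^ n * M                  ≡⟨ cong (_* M) powers ⟩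
      K * (8 * q) ^ n * M                              ≡⟨ ℕP.*-assoc K _ M ⟩
      K * ((8 * q) ^ n * M)                            ∎)
    where
    open ℕP.≤-Reasoning
    M = length Y
    base : ∀ q x → 2 * (4 * q * x) ≡ x * (8 * q)
    base = ℕ-solve-∀
    powers : 2 ^ n * (4 * q * 2 ^ l) ^ n ≡ K * (8 * q) ^ n
    powers = begin-equality
      2 ^ n * (4 * q * 2 ^ l) ^ n    ≡⟨ ^-distribʳ-* 2 (4 * q * 2 ^ l) n ⟨
      (2 * (4 * q * 2 ^ l)) ^ n      ≡⟨ cong (_^ n) (base q (2 ^ l)) ⟩
      (2 ^ l * (8 * q)) ^ n          ≡⟨ ^-distribʳ-* (2 ^ l) (8 * q) n ⟩
      (2 ^ l) ^ n * (8 * q) ^ n      ≡⟨ cong (_* (8 * q) ^ n) (trans (ℕP.^-*-assoc 2 l n) (cong (2 ^_) (ℕP.*-comm l n))) ⟩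
      K * (8 * q) ^ n                ∎

-- Induction on `l` keeps `q` until `l` reaches `q * q` and then passes to `suc q`; the factor 4
-- leaves room for that jump.
sqrt-bounds : ∀ l → 1 ≤ l → ∃ λ q → NonZero q × l ≤ q * q × q * q ≤ 4 * l
sqrt-bounds (suc zero)    _ = 1 , _ , ℕP.≤-refl , s≤s z≤n
sqrt-bounds (suc (suc l)) _ with sqrt-bounds (suc l) (s≤s z≤n)
... | q , q≢0 , l≤ , ≤4l with ℕP.m≤n⇒m<n∨m≡n l≤
... | inj₁ l< = q , q≢0 , l< , ℕP.≤-trans ≤4l (ℕP.*-monoʳ-≤ 4 (ℕP.n≤1+n (suc l)))
... | inj₂ eq = suc q , _ , lower-bound , upper-bound
  where
  open ℕP.≤-Reasoning
  expand : ∀ q → suc q * suc q ≡ suc (q * q + 2 * q)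
  expand = ℕ-solve-∀
  lower-bound : suc (suc l) ≤ suc q * suc q
  lower-bound = begin
    suc (suc l)              ≡⟨ cong suc eq ⟩
    suc (q * q)              ≤⟨ s≤s (ℕP.m≤m+n (q * q) (2 * q)) ⟩
    suc (q * q + 2 * q)      ≡⟨ expand q ⟨
    suc q * suc q            ∎
  slack : ∀ x → suc (x + 2 * x) + (3 + x) ≡ 4 * suc x
  slack = ℕ-solve-∀
  upper-bound : suc q * suc q ≤ 4 * suc (suc l)
  upper-bound = begin
    suc q * suc q                   ≡⟨ expand q ⟩
    suc (q * q + 2 * q)             ≤⟨ s≤s (ℕP.+-monoʳ-≤ (q * q) (ℕP.*-monoʳ-≤ 2 (m≤m*m q))) ⟩
    suc (q * q + 2 * (q * q))       ≤⟨ ℕP.m≤m+n _ (3 + q * q) ⟩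
    suc (q * q + 2 * (q * q)) + (3 + q * q) ≡⟨ slack (q * q) ⟩
    4 * suc (q * q)                 ≡⟨ cong (λ y → 4 * suc y) eq ⟨
    4 * suc (suc l)                 ∎

-- Sums over composite indices, indicators and Kronecker deltas.

module SumLemmas {c ℓ} (M : CommutativeMonoid c ℓ) where
  open CommutativeMonoid M renaming (refl to ≈-refl; sym to ≈-sym; trans to ≈-trans)
  open MonoidSum M renaming (sum to ∑ᴹ)

  sum-zero : ∀ {n} (g : Fin n → Carrier) → (∀ i → g i ≈ ε) → ∑ᴹ g ≈ ε
  sum-zero {n} g g≈ε = ≈-trans (sum-cong-≋ g≈ε) (sum-replicate-zero n)

  sum-single : ∀ {n} (g : Fin n → Carrier) i → (∀ j → j ≢ i → g j ≈ ε) → ∑ᴹ g ≈ g i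
  sum-single {suc n} g i g≈ε = ≈-trans (sum-remove g)
    (≈-trans (∙-congˡ (sum-zero _ λ j → g≈ε _ (punchInᵢ≢i i j))) (identityʳ (g i)))

  sum-splitAt : ∀ m {n} (g : Fin (m + n) → Carrier) →
    ∑ᴹ g ≈ ∑ᴹ (λ i → g (i ↑ˡ n)) ∙ ∑ᴹ (λ j → g (m ↑ʳ j))
  sum-splitAt zero    g = ≈-sym (identityˡ _)
  sum-splitAt (suc m) g = ≈-trans (∙-congˡ (sum-splitAt m (g ∘ suc))) (≈-sym (assoc _ _ _))

  sum-combine : ∀ m {n} (g : Fin (m * n) → Carrier) →
    ∑ᴹ g ≈ ∑ᴹ {m} (λ j → ∑ᴹ {n} (λ x → g (combine j x)))
  sum-combine zero        g = ≈-refl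
  sum-combine (suc m) {n} g = ≈-trans (sum-splitAt n g) (∙-congˡ (sum-combine m (λ i → g (n ↑ʳ i))))

module ℕ∑ = SumLemmas ℕP.+-0-commutativeMonoid
module ℤ∑ = SumLemmas ℤP.+-0-commutativeMonoid

≤-∑ : ∀ {n} (g : Fin n → ℕ) i → g i ≤ ∑ g
≤-∑ g zero    = ℕP.m≤m+n _ _
≤-∑ g (suc i) = ℕP.≤-trans (≤-∑ (g ∘ suc) i) (ℕP.m≤n+m _ (g zero))

+-≤-∑ : ∀ {n} (g : Fin n → ℕ) {i j} → i ≢ j → g i + g j ≤ ∑ g
+-≤-∑ g {zero}  {zero}  i≢j = contradiction refl i≢j
+-≤-∑ g {zero}  {suc j} i≢j = ℕP.+-monoʳ-≤ (g zero) (≤-∑ (g ∘ suc) j)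
+-≤-∑ g {suc i} {zero}  i≢j = subst (_≤ ∑ g) (ℕP.+-comm (g zero) (g (suc i))) (ℕP.+-monoʳ-≤ (g zero) (≤-∑ (g ∘ suc) i))
+-≤-∑ g {suc i} {suc j} i≢j = ℕP.≤-trans (+-≤-∑ (g ∘ suc) (i≢j ∘ cong suc)) (ℕP.m≤n+m _ (g zero))

-- The index `i` forces `n` to be positive, so `n ∸ 1` counts the other indices exactly. It serves
-- to count neighbours slice by slice.
∑-ones-but : ∀ {n} (g : Fin n → ℕ) i → (∀ j → j ≢ i → g j ≡ 1) → ∑ g ≡ g i + (n ∸ 1)
∑-ones-but {suc n} g i ones = trans (MonoidSum.sum-remove ℕP.+-0-commutativeMonoid g)
  (cong (λ y → g i + y) (trans (∑-cong λ j → ones _ (punchInᵢ≢i i j)) (trans (∑-const n 1) (ℕP.*-identityʳ n))))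

𝟙 : ∀ {p} {P : Set p} → Dec P → ℕ
𝟙 d = if does d then 1 else 0

module _ {p q} {P : Set p} {Q : Set q} (P? : Dec P) (Q? : Dec Q) where
  𝟙-cong : P ⇔ Q → 𝟙 P? ≡ 𝟙 Q?
  𝟙-cong P⇔Q = cong (if_then 1 else 0) (does-⇔ P⇔Q P? Q?)

𝟙-true : ∀ {p} {P : Set p} (P? : Dec P) → P → 𝟙 P? ≡ 1
𝟙-true P? p = cong (if_then 1 else 0) (dec-true P? p)

𝟙-false : ∀ {p} {P : Set p} (P? : Dec P) → ¬ P → 𝟙 P? ≡ 0
𝟙-false P? ¬p = cong (if_then 1 else 0) (dec-false P? ¬p)

count : ∀ {n p} {P : Pred (Fin n) p} → Decidable P → ℕ
count P? = ∑ λ i → 𝟙 (P? i)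

-- As sums of indicators, the filtered lists behind `degree` and `dist` can be split over slices.
length-filter-allFin : ∀ {n p} {P : Pred (Fin n) p} (P? : Decidable P) → length (filter P? (allFin n)) ≡ count P?
length-filter-allFin P? = go P? id
  where
  -- The tail of `allFin` is a tabulation of `suc`, so the induction runs over arbitrary tabulated
  -- functions.
  go : ∀ {A : Set} {n p} {P : Pred A p} (P? : Decidable P) (h : Fin n → A) →
    length (filter P? (tabulate h)) ≡ ∑ (λ i → 𝟙 (P? (h i)))
  go {n = zero}  P? h = refl
  go {n = suc n} P? h with does (P? (h zero))
  ... | true  = cong suc (go P? (h ∘ suc))
  ... | false = go P? (h ∘ suc)

δ : ∀ {n} → Fin n → Fin n → ℤ
δ i j = if does (i ≟ j) then + 1 else + 0

δ-refl : ∀ {n} (i : Fin n) → δ i i ≡ + 1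
δ-refl i = cong (if_then + 1 else + 0) (dec-true (i ≟ i) refl)

δ-≢ : ∀ {n} {i j : Fin n} → i ≢ j → δ i j ≡ + 0
δ-≢ {i = i} {j} i≢j = cong (if_then + 1 else + 0) (dec-false (i ≟ j) i≢j)

∑-δ : ∀ {n} i (g : Fin n → ℤ) → ∑ℤ (λ j → δ i j ℤ.* g j) ≡ g i
∑-δ i g = trans (ℤ∑.sum-single _ i λ j j≢i → cong (ℤ._* g j) (δ-≢ (j≢i ∘ sym)))
  (trans (cong (ℤ._* g i) (δ-refl i)) (ℤP.*-identityˡ (g i)))

∑-δ² : ∀ {n} (i : Fin n) → ∑ (λ j → ∣ δ i j ∣ * ∣ δ i j ∣) ≡ 1
∑-δ² i = trans (ℕ∑.sum-single _ i λ j j≢i → cong (λ y → ∣ y ∣ * ∣ y ∣) (δ-≢ (j≢i ∘ sym)))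
  (cong (λ y → ∣ y ∣ * ∣ y ∣) (δ-refl i))

δ-sym : ∀ {n} (i j : Fin n) → δ i j ≡ δ j i
δ-sym i j = cong (if_then + 1 else + 0) (does-⇔ (mk⇔ sym sym) (i ≟ j) (j ≟ i))

-- Cubes and their axis-parallel lines.

-- The incidence matrix of a disjoint union of cubes [l]^f, with axis-parallel lines of l points as rows.
record Grid (l f N : ℕ) : Set where
  field
    lines     : ℕ
    incidence : Fin lines → Fin N → ℤ
    lines*l   : lines * l ≡ f * N
    row-norm  : ∀ L → ∑ (λ i → ∣ incidence L i ∣ * ∣ incidence L i ∣) ≡ l
    degrees   : ∀ i → count (λ j → ¬? (j ≟ i) ×-dec ¬? (coupling incidence i j ℤ.≟ + 0)) ≡ f * (l ∸ 1)
    support   : ∀ (d : Fin N → ℤ) → (∀ L → ∑ℤ (λ i → incidence L i ℤ.* d i) ≡ + 0) →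
                ∀ i → d i ≢ + 0 → 2 ^ f ≤ count (λ i → ¬? (d i ℤ.≟ + 0))

-- In dimension zero all points are isolated, and a nonzero function is nonzero in at least `2 ^ 0`
-- places.
points : ∀ l N → Grid l 0 N
points l N = record
  { lines     = 0
  ; incidence = λ ()
  ; lines*l   = refl
  ; row-norm  = λ ()
  ; degrees   = λ i → ℕ∑.sum-zero _ λ j → 𝟙-false (¬? (j ≟ i) ×-dec ¬? (+ 0 ℤ.≟ + 0)) λ (_ , 0≢0) → 0≢0 refl
  ; support   = λ d _ i d≢0 → subst (_≤ _) (𝟙-true (¬? (d i ℤ.≟ + 0)) d≢0) (≤-∑ (λ i → 𝟙 (¬? (d i ℤ.≟ + 0))) i)
  }

-- Otherwise the sum would collapse to its nonzero term at `i`.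
∃-other-nonzero : ∀ {n} (g : Fin n → ℤ) i → ∑ℤ g ≡ + 0 → g i ≢ + 0 → ∃ λ j → j ≢ i × g j ≢ + 0
∃-other-nonzero g i ∑≡0 gi≢0 with any? (λ j → ¬? (j ≟ i) ×-dec ¬? (g j ℤ.≟ + 0))
... | yes found = found
... | no none   = contradiction (trans (sym (ℤ∑.sum-single g i zero-elsewhere)) ∑≡0) gi≢0
  where
  zero-elsewhere : ∀ j → j ≢ i → g j ≡ + 0
  zero-elsewhere j j≢i = decidable-stable (g j ℤ.≟ + 0) λ gj≢0 → none (j , j≢i , gj≢0)

combine-elim : ∀ {p} m {n} (P : Pred (Fin (m * n)) p) → (∀ j x → P (combine {m} {n} j x)) → ∀ i → P i
combine-elim m {n} P p i = subst P (combine-remQuot {m} n i) (p _ _)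

splitAt-elim : ∀ {p} m {n} (P : Pred (Fin (m + n)) p) → (∀ i → P (i ↑ˡ n)) → (∀ j → P (m ↑ʳ j)) → ∀ i → P i
splitAt-elim m {n} P pˡ pʳ i = subst P (join-splitAt m n i) (go (splitAt m i))
  where
  go : ∀ s → P (Fin.join m n s)
  go (inj₁ i) = pˡ i
  go (inj₂ j) = pʳ j

-- Adding one dimension: `l` parallel slices joined by transversals.

module Prism {l f N} (G : Grid l f N) where
  open Grid G

  -- A line of the prism is either the copy of `L` in slice `j`, or the transversal over the base
  -- point `x`, which meets every slice once.
  entry : (Fin l × Fin lines) ⊎ Fin N → Fin l × Fin N → ℤ
  entry (inj₁ (j , L)) (j′ , x) = δ j j′ ℤ.* incidence L x
  entry (inj₂ x)       (_ , x′) = δ x x′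

  incidence′ : Fin (l * lines + N) → Fin (l * N) → ℤ
  incidence′ L i = entry (map₁ (remQuot {l} lines) (splitAt (l * lines) L)) (remQuot {l} N i)

  slice : Fin l → Fin lines → Fin (l * lines + N)
  slice j L = combine j L ↑ˡ N

  across : Fin N → Fin (l * lines + N)
  across x = (l * lines) ↑ʳ x

  incidence-slice : ∀ j L j′ x → incidence′ (slice j L) (combine j′ x) ≡ δ j j′ ℤ.* incidence L x
  incidence-slice j L j′ x = cong₂ entry
    (trans (cong (map₁ (remQuot {l} lines)) (splitAt-↑ˡ (l * lines) (combine j L) N)) (cong inj₁ (remQuot-combine j L)))
    (remQuot-combine j′ x)

  incidence-across : ∀ x j′ x′ → incidence′ (across x) (combine j′ x′) ≡ δ x x′
  incidence-across x j′ x′ = cong₂ entry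
    (cong (map₁ (remQuot {l} lines)) (splitAt-↑ʳ (l * lines) N x))
    (remQuot-combine {l} j′ x′)

  size : (l * lines + N) * l ≡ suc f * (l * N)
  size = begin
    (l * lines + N) * l      ≡⟨ expand l lines N ⟩
    l * N + l * (lines * l)  ≡⟨ cong (λ y → l * N + l * y) lines*l ⟩
    l * N + l * (f * N)      ≡⟨ collect l f N ⟩
    suc f * (l * N)          ∎
    where
    open ≡-Reasoning
    expand : ∀ l n N → (l * n + N) * l ≡ l * N + l * (n * l)
    expand = ℕ-solve-∀
    collect : ∀ l f N → l * N + l * (f * N) ≡ suc f * (l * N)
    collect = ℕ-solve-∀

  ∣_∣² : ℤ → ℕ
  ∣ z ∣² = ∣ z ∣ * ∣ z ∣

  row-norm′ : ∀ L → ∑ (λ i → ∣ incidence′ L i ∣²) ≡ l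
  row-norm′ = splitAt-elim (l * lines) _ (combine-elim l _ slice-norm) across-norm
    where
    open ≡-Reasoning
    slice-norm : ∀ j L → ∑ (λ i → ∣ incidence′ (slice j L) i ∣²) ≡ l
    slice-norm j L = begin
      ∑ (λ i → ∣ incidence′ (slice j L) i ∣²)
        ≡⟨ ℕ∑.sum-combine l _ ⟩
      ∑ {l} (λ j′ → ∑ λ x → ∣ incidence′ (slice j L) (combine j′ x) ∣²)
        ≡⟨ ∑-cong (λ j′ → ∑-cong λ x → cong ∣_∣² (incidence-slice j L j′ x)) ⟩
      ∑ (λ j′ → ∑ λ x → ∣ δ j j′ ℤ.* incidence L x ∣²)
        ≡⟨ ℕ∑.sum-single _ j (λ j′ j′≢j → ℕ∑.sum-zero _ λ x → cong (λ y → ∣ y ℤ.* incidence L x ∣²) (δ-≢ (j′≢j ∘ sym))) ⟩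
      ∑ (λ x → ∣ δ j j ℤ.* incidence L x ∣²)
        ≡⟨ ∑-cong (λ x → cong ∣_∣² (trans (cong (ℤ._* incidence L x) (δ-refl j)) (ℤP.*-identityˡ _))) ⟩
      ∑ (λ x → ∣ incidence L x ∣²)
        ≡⟨ row-norm L ⟩
      l ∎
    across-norm : ∀ x → ∑ (λ i → ∣ incidence′ (across x) i ∣²) ≡ l
    across-norm x = begin
      ∑ (λ i → ∣ incidence′ (across x) i ∣²)
        ≡⟨ ℕ∑.sum-combine l _ ⟩
      ∑ {l} (λ j′ → ∑ λ x′ → ∣ incidence′ (across x) (combine j′ x′) ∣²)
        ≡⟨ ∑-cong {l} (λ j′ → trans (∑-cong λ x′ → cong ∣_∣² (incidence-across x j′ x′)) (∑-δ² x)) ⟩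
      ∑ {l} (λ j′ → 1)
        ≡⟨ trans (∑-const l 1) (ℕP.*-identityʳ l) ⟩
      l ∎

  -- Two points share lines of the first kind only within one slice, where they share the old ones,
  -- and they share a transversal only over the same base point.
  coupling-combine : ∀ j x j′ x′ →
    coupling incidence′ (combine j x) (combine j′ x′) ≡ δ j j′ ℤ.* coupling incidence x x′ ℤ.+ δ x x′
  coupling-combine j x j′ x′ = trans (ℤ∑.sum-splitAt (l * lines) _) (cong₂ ℤ._+_ slices acrosses)
    where
    open ≡-Reasoning
    regroup : ∀ a b c d → (a ℤ.* b) ℤ.* (c ℤ.* d) ≡ a ℤ.* (c ℤ.* (b ℤ.* d))
    regroup = solve-∀
    slices : ∑ℤ (λ e → incidence′ (e ↑ˡ N) (combine j x) ℤ.* incidence′ (e ↑ˡ N) (combine j′ x′))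
      ≡ δ j j′ ℤ.* coupling incidence x x′
    slices = begin
      ∑ℤ (λ e → incidence′ (e ↑ˡ N) (combine j x) ℤ.* incidence′ (e ↑ˡ N) (combine j′ x′))
        ≡⟨ ℤ∑.sum-combine l _ ⟩
      ∑ℤ {l} (λ k → ∑ℤ λ L → incidence′ (slice k L) (combine j x) ℤ.* incidence′ (slice k L) (combine j′ x′))
        ≡⟨ ∑ℤ-cong (λ k → ∑ℤ-cong λ L → trans
             (cong₂ ℤ._*_ (trans (incidence-slice k L j x) (cong (ℤ._* incidence L x) (δ-sym k j))) (incidence-slice k L j′ x′))
             (regroup (δ j k) (incidence L x) (δ k j′) (incidence L x′))) ⟩
      ∑ℤ (λ k → ∑ℤ λ L → δ j k ℤ.* (δ k j′ ℤ.* (incidence L x ℤ.* incidence L x′)))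
        ≡⟨ ∑ℤ-cong (λ k → sym (∑ℤ-*ˡ (δ j k) (λ L → δ k j′ ℤ.* (incidence L x ℤ.* incidence L x′)))) ⟩
      ∑ℤ (λ k → δ j k ℤ.* ∑ℤ λ L → δ k j′ ℤ.* (incidence L x ℤ.* incidence L x′))
        ≡⟨ ∑-δ j (λ k → ∑ℤ λ L → δ k j′ ℤ.* (incidence L x ℤ.* incidence L x′)) ⟩
      ∑ℤ (λ L → δ j j′ ℤ.* (incidence L x ℤ.* incidence L x′))
        ≡⟨ ∑ℤ-*ˡ (δ j j′) (λ L → incidence L x ℤ.* incidence L x′) ⟨
      δ j j′ ℤ.* coupling incidence x x′ ∎
    acrosses : ∑ℤ (λ y → incidence′ (across y) (combine j x) ℤ.* incidence′ (across y) (combine j′ x′)) ≡ δ x x′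
    acrosses = trans
      (∑ℤ-cong λ y → cong₂ ℤ._*_ (trans (incidence-across y j x) (δ-sym y x)) (incidence-across y j′ x′))
      (∑-δ x (λ y → δ y x′))

  -- A point has `f * (l ∸ 1)` neighbours in its own slice and one, its translate, in each of the
  -- `l ∸ 1` other slices.
  degrees′ : ∀ i → count (λ i′ → ¬? (i′ ≟ i) ×-dec ¬? (coupling incidence′ i i′ ℤ.≟ + 0)) ≡ suc f * (l ∸ 1)
  degrees′ = combine-elim l _ λ j x → trans (ℕ∑.sum-combine l _)
    (trans (∑-ones-but _ j (other-slice j x)) (trans (cong (_+ (l ∸ 1)) (same-slice j x)) (ℕP.+-comm _ (l ∸ 1))))
    where
    adjacent? : ∀ i → Decidable (λ i′ → i′ ≢ i × coupling incidence′ i i′ ≢ + 0)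
    adjacent? i i′ = ¬? (i′ ≟ i) ×-dec ¬? (coupling incidence′ i i′ ℤ.≟ + 0)

    coupling-same : ∀ j x x′ → x′ ≢ x → coupling incidence′ (combine j x) (combine j x′) ≡ coupling incidence x x′
    coupling-same j x x′ x′≢x = trans (coupling-combine j x j x′)
      (trans (cong₂ (λ a b → a ℤ.* coupling incidence x x′ ℤ.+ b) (δ-refl j) (δ-≢ (x′≢x ∘ sym)))
        (trans (ℤP.+-identityʳ _) (ℤP.*-identityˡ _)))

    coupling-other : ∀ j x j′ x′ → j′ ≢ j → coupling incidence′ (combine j x) (combine j′ x′) ≡ δ x x′
    coupling-other j x j′ x′ j′≢j = trans (coupling-combine j x j′ x′)
      (trans (cong (λ a → a ℤ.* coupling incidence x x′ ℤ.+ δ x x′) (δ-≢ (j′≢j ∘ sym))) (ℤP.+-identityˡ _))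

    same-slice : ∀ j x → ∑ (λ x′ → 𝟙 (adjacent? (combine j x) (combine j x′))) ≡ f * (l ∸ 1)
    same-slice j x = trans (∑-cong λ x′ → 𝟙-cong (adjacent? (combine j x) (combine j x′))
        (¬? (x′ ≟ x) ×-dec ¬? (coupling incidence x x′ ℤ.≟ + 0)) (mk⇔
          (λ (≢ , ≢0) → ≢ ∘ cong (combine j) , ≢0 ∘ trans (coupling-same j x x′ (≢ ∘ cong (combine j))))
          (λ (≢ , ≢0) → ≢ ∘ combine-injectiveʳ j x′ j x , ≢0 ∘ trans (sym (coupling-same j x x′ ≢)))))
      (degrees x)

    other-slice : ∀ j x j′ → j′ ≢ j → ∑ (λ x′ → 𝟙 (adjacent? (combine j x) (combine j′ x′))) ≡ 1
    other-slice j x j′ j′≢j = trans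
      (ℕ∑.sum-single _ x λ x′ x′≢x → 𝟙-false (adjacent? (combine j x) (combine j′ x′)) λ (_ , ≢0) →
        ≢0 (trans (coupling-other j x j′ x′ j′≢j) (δ-≢ (x′≢x ∘ sym))))
      (𝟙-true (adjacent? (combine j x) (combine j′ x))
        ( (λ eq → j′≢j (combine-injectiveˡ j′ x j x eq))
        , (λ ≡0 → contradiction (trans (sym (δ-refl x)) (trans (sym (coupling-other j x j′ x j′≢j)) ≡0)) λ ())))

  -- A nonzero slice meets, along a transversal line, a second nonzero slice, so the support doubles.
  support′ : ∀ (d : Fin (l * N) → ℤ) → (∀ L → ∑ℤ (λ i → incidence′ L i ℤ.* d i) ≡ + 0) →
    ∀ i → d i ≢ + 0 → 2 ^ suc f ≤ count (λ i → ¬? (d i ℤ.≟ + 0))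
  support′ d flat = combine-elim l _ doubled
    where
    slice-flat : ∀ j L → ∑ℤ (λ x → incidence L x ℤ.* d (combine j x)) ≡ + 0
    slice-flat j L = trans (sym (begin
      ∑ℤ (λ i → incidence′ (slice j L) i ℤ.* d i)
        ≡⟨ ℤ∑.sum-combine l _ ⟩
      ∑ℤ {l} (λ j′ → ∑ℤ λ x → incidence′ (slice j L) (combine j′ x) ℤ.* d (combine j′ x))
        ≡⟨ ∑ℤ-cong (λ j′ → trans
             (∑ℤ-cong λ x → trans (cong (ℤ._* d (combine j′ x)) (incidence-slice j L j′ x)) (ℤP.*-assoc (δ j j′) _ _))
             (sym (∑ℤ-*ˡ (δ j j′) (λ x → incidence L x ℤ.* d (combine j′ x))))) ⟩
      ∑ℤ (λ j′ → δ j j′ ℤ.* ∑ℤ λ x → incidence L x ℤ.* d (combine j′ x))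
        ≡⟨ ∑-δ j (λ j′ → ∑ℤ λ x → incidence L x ℤ.* d (combine j′ x)) ⟩
      ∑ℤ (λ x → incidence L x ℤ.* d (combine j x)) ∎)) (flat (slice j L))
      where open ≡-Reasoning

    across-flat : ∀ x → ∑ℤ {l} (λ j → d (combine j x)) ≡ + 0
    across-flat x = trans (sym (trans (ℤ∑.sum-combine l _)
      (∑ℤ-cong {l} λ j → trans (∑ℤ-cong λ x′ → cong (ℤ._* d (combine j x′)) (incidence-across x j x′))
        (∑-δ x (λ x′ → d (combine j x′)))))) (flat (across x))

    doubled : ∀ j x → d (combine j x) ≢ + 0 → 2 ^ suc f ≤ count (λ i → ¬? (d i ℤ.≟ + 0))
    doubled j x d≢0 with ∃-other-nonzero (λ j → d (combine j x)) j (across-flat x) d≢0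
    ... | j′ , j′≢j , d′≢0 = begin
      2 ^ f + (2 ^ f + 0)     ≡⟨ cong (λ y → 2 ^ f + y) (ℕP.+-identityʳ (2 ^ f)) ⟩
      2 ^ f + 2 ^ f           ≤⟨ ℕP.+-mono-≤ (support (d ∘ combine j′) (slice-flat j′) x d′≢0)
                                             (support (d ∘ combine j) (slice-flat j) x d≢0) ⟩
      slice-count j′ + slice-count j  ≤⟨ +-≤-∑ slice-count j′≢j ⟩
      ∑ slice-count                   ≡⟨ ℕ∑.sum-combine l _ ⟨
      count (λ i → ¬? (d i ℤ.≟ + 0))  ∎
      where
      open ℕP.≤-Reasoning
      slice-count : Fin l → ℕ
      slice-count j = count (λ x → ¬? (d (combine j x) ℤ.≟ + 0))

  prism : Grid l (suc f) (l * N)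
  prism = record
    { lines     = l * lines + N
    ; incidence = incidence′
    ; lines*l   = size
    ; row-norm  = row-norm′
    ; degrees   = degrees′
    ; support   = support′
    }

-- Starting from `k` isolated points produces `k` disjoint cubes; `subst` reorders the factors of
-- the number of points.
cubes : ∀ l f k → Grid l f (k * l ^ f)
cubes l zero    k = points l (k * 1)
cubes l (suc f) k = subst (Grid l (suc f)) (regroup l k (l ^ f)) (Prism.prism (cubes l f k))
  where
  regroup : ∀ l k x → l * (k * x) ≡ k * (l * x)
  regroup = ℕ-solve-∀

-- Distances between global minima and the final count.

lookup-injective : ∀ {A : Set} {X : List A} → Unique X → ∀ i j → List.lookup X i ≡ List.lookup X j → i ≡ j
lookup-injective (x∉ ∷ u) zero    zero    eq = refl
lookup-injective (x∉ ∷ u) zero    (suc j) eq = contradiction eq (All.lookup x∉ (∈-lookup j))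
lookup-injective (x∉ ∷ u) (suc i) zero    eq = contradiction (sym eq) (All.lookup x∉ (∈-lookup i))
lookup-injective (x∉ ∷ u) (suc i) (suc j) eq = cong suc (lookup-injective u i j eq)

spin-injective : ∀ {b c} → spin b ≡ spin c → b ≡ c
spin-injective {true}  {true}  _ = refl
spin-injective {false} {false} _ = refl

module _ {l f N} (G : Grid l f N) where
  open Grid G

  -- The difference of the two spin vectors sums to zero along every line and its support has size
  -- `dist A B`, so the support bound of the grid applies.
  balanced-distance : ∀ (t : Fin lines → ℤ) {A B} → Balanced incidence t A → Balanced incidence t B →
    1 ≤ dist A B → 2 ^ f ≤ dist A B
  balanced-distance t {A} {B} balA balB 1≤dist =
    subst (2 ^ f ≤_) (sym dist≡) (support d flat (proj₁ differ) (proj₂ differ))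
    where
    d : Fin N → ℤ
    d i = spin (lookup A i) ℤ.- spin (lookup B i)

    dist≡ : dist A B ≡ count (λ i → ¬? (d i ℤ.≟ + 0))
    dist≡ = trans (length-filter-allFin (λ i → ¬? (lookup A i BoolP.≟ lookup B i)))
      (∑-cong λ i → 𝟙-cong (¬? (lookup A i BoolP.≟ lookup B i)) (¬? (d i ℤ.≟ + 0)) (mk⇔
        (λ ≢ ≡0 → ≢ (spin-injective (ℤP.i-j≡0⇒i≡j _ _ ≡0)))
        (λ ≢0 eq → ≢0 (ℤP.i≡j⇒i-j≡0 (cong spin eq)))))

    differ : ∃ λ i → d i ≢ + 0
    differ with any? (λ i → ¬? (d i ℤ.≟ + 0))
    ... | yes found = found
    ... | no none   = contradiction (subst (1 ≤_) (trans dist≡ (ℕ∑.sum-zero _ λ i →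
                        𝟙-false (¬? (d i ℤ.≟ + 0)) λ ≢0 → none (i , ≢0))) 1≤dist) λ ()

    flat : ∀ L → ∑ℤ (λ i → incidence L i ℤ.* d i) ≡ + 0
    flat L = begin
      ∑ℤ (λ i → incidence L i ℤ.* d i)
        ≡⟨ ∑ℤ-cong (λ i → distrib (incidence L i) (spin (lookup A i)) (spin (lookup B i))) ⟩
      ∑ℤ (λ i → incidence L i ℤ.* spin (lookup A i) ℤ.+ - (+ 1) ℤ.* (incidence L i ℤ.* spin (lookup B i)))
        ≡⟨ ∑ℤ-+ (λ i → incidence L i ℤ.* spin (lookup A i)) _ ⟩
      load (incidence L) A ℤ.+ ∑ℤ (λ i → - (+ 1) ℤ.* (incidence L i ℤ.* spin (lookup B i)))
        ≡⟨ cong (λ y → load (incidence L) A ℤ.+ y) (∑ℤ-*ˡ (- (+ 1)) (λ i → incidence L i ℤ.* spin (lookup B i))) ⟨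
      load (incidence L) A ℤ.+ - (+ 1) ℤ.* load (incidence L) B
        ≡⟨ cong₂ (λ x y → x ℤ.+ - (+ 1) ℤ.* y) (balA L) (balB L) ⟩
      t L ℤ.+ - (+ 1) ℤ.* t L
        ≡⟨ vanish (t L) ⟩
      + 0 ∎
      where
      open ≡-Reasoning
      distrib : ∀ a x y → a ℤ.* (x ℤ.- y) ≡ a ℤ.* x ℤ.+ - (+ 1) ℤ.* (a ℤ.* y)
      distrib = solve-∀
      vanish : ∀ x → x ℤ.+ - (+ 1) ℤ.* x ≡ + 0
      vanish = solve-∀

-- It extracts from the counting bound a balanced assignment, whose existence identifies the global
-- minima with the balanced assignments.
2^n≤m*length⇒∈ : ∀ {A : Set} N x (Y : List A) → 2 ^ N ≤ x * length Y → ∃ λ y → y ∈ Y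
2^n≤m*length⇒∈ N x []      le = contradiction (ℕP.≤-trans (ℕP.m^n>0 2 N) (subst (2 ^ N ≤_) (ℕP.*-zeroʳ x) le)) λ ()
2^n≤m*length⇒∈ N x (y ∷ Y) le = y , here refl

-- This is the bound of the theorem for `c = 1/16`, raised to the power `2 * l`: the power removes
-- the division by `l` in the exponent and the square root of `l`.
clear-roots : ∀ {l f N n q M} → 1 ≤ f → n * l ≡ f * N → q * q ≤ 4 * l → 2 ^ N ≤ (8 * q) ^ n * M →
  2 ^ (2 * l * N) ≤ M ^ (2 * l) * (16 * 16 * (f * f) * l) ^ (N * f)
clear-roots {l} {f} {N} {n} {q} {M} 1≤f nl≡fN q²≤4l le = begin
  2 ^ (2 * l * N)                          ≡⟨ cong (2 ^_) (ℕP.*-comm (2 * l) N) ⟩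
  2 ^ (N * (2 * l))                        ≡⟨ ℕP.^-*-assoc 2 N (2 * l) ⟨
  (2 ^ N) ^ (2 * l)                        ≤⟨ ℕP.^-monoˡ-≤ (2 * l) le ⟩
  ((8 * q) ^ n * M) ^ (2 * l)              ≡⟨ ^-distribʳ-* ((8 * q) ^ n) M (2 * l) ⟩
  ((8 * q) ^ n) ^ (2 * l) * M ^ (2 * l)    ≡⟨ ℕP.*-comm _ (M ^ (2 * l)) ⟩
  M ^ (2 * l) * ((8 * q) ^ n) ^ (2 * l)    ≤⟨ ℕP.*-monoʳ-≤ (M ^ (2 * l)) bound ⟩
  M ^ (2 * l) * (16 * 16 * (f * f) * l) ^ (N * f) ∎
  where
  open ℕP.≤-Reasoning
  exponent : n * (2 * l) ≡ 2 * (N * f)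
  exponent = trans (regroup n l) (cong (2 *_) (trans nl≡fN (ℕP.*-comm f N)))
    where
    regroup : ∀ n l → n * (2 * l) ≡ 2 * (n * l)
    regroup = ℕ-solve-∀
  square : ∀ q → (8 * q) ^ 2 ≡ 64 * (q * q)
  square q = trans (cong (λ y → 8 * q * y) (ℕP.*-identityʳ (8 * q))) (regroup q)
    where
    regroup : ∀ q → 8 * q * (8 * q) ≡ 64 * (q * q)
    regroup = ℕ-solve-∀
  base : 64 * (q * q) ≤ 16 * 16 * (f * f) * l
  base = begin
    64 * (q * q)            ≤⟨ ℕP.*-monoʳ-≤ 64 q²≤4l ⟩
    64 * (4 * l)            ≡⟨ ℕP.*-assoc 64 4 l ⟨
    -- From `q * q ≤ 4 * l` the square of `8 * q` is at most `16 * 16 * l`, and `1 ≤ f` brings in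
    -- the factor `f * f`.
    16 * 16 * 1 * l         ≤⟨ ℕP.*-monoˡ-≤ l (ℕP.*-monoʳ-≤ (16 * 16) (ℕP.*-mono-≤ 1≤f 1≤f)) ⟩
    16 * 16 * (f * f) * l   ∎
  bound : ((8 * q) ^ n) ^ (2 * l) ≤ (16 * 16 * (f * f) * l) ^ (N * f)
  bound = begin
    ((8 * q) ^ n) ^ (2 * l)     ≡⟨ ℕP.^-*-assoc (8 * q) n (2 * l) ⟩
    (8 * q) ^ (n * (2 * l))     ≡⟨ cong ((8 * q) ^_) exponent ⟩
    (8 * q) ^ (2 * (N * f))     ≡⟨ ℕP.^-*-assoc (8 * q) 2 (N * f) ⟨
    ((8 * q) ^ 2) ^ (N * f)     ≡⟨ cong (_^ (N * f)) (square q) ⟩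
    (64 * (q * q)) ^ (N * f)    ≤⟨ ℕP.^-monoˡ-≤ (N * f) base ⟩
    (16 * 16 * (f * f) * l) ^ (N * f) ∎

theorem1 : Σ ℕ λ m → 1 ≤ m ×
    (∀ (f l k : ℕ) → 1 ≤ f → 1 ≤ l → 1 ≤ k →
      Σ (Ising (k * l ^ f)) λ I →
        (∀ (i : Fin (k * l ^ f)) → degree I i ≡ f * (l ∸ 1))
        × (Σ ℕ λ M →
             (2 ^ (2 * l * (k * l ^ f)) ≤ M ^ (2 * l) * (m * m * (f * f) * l) ^ ((k * l ^ f) * f))
             × AtLeastGlobalMins I M)
        × (∀ A → GlobalMin I A → KMin (2 ^ f ∸ 1) I A))
-- The witness 16 is the reciprocal of the constant `c`.
theorem1 = 16 , s≤s z≤n , λ f l k 1≤f 1≤l 1≤k →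
  let N = k * l ^ f
      open Grid (cubes l f k)
      q , q≢0 , l≤q² , q²≤4l = sqrt-bounds l 1≤l
      t , Y , unique , bal , 2^N≤ = popular-load incidence l q {{q≢0}} row-norm l≤q²
      S₀ , S₀∈Y = 2^n≤m*length⇒∈ N ((8 * q) ^ lines) Y 2^N≤
  in ising incidence t
   , (λ i → trans (length-filter-allFin (λ j → ¬? (j ≟ i) ×-dec ¬? (coupling incidence i j ℤ.≟ + 0))) (degrees i))
   , (length Y , clear-roots {l} {f} {N} {lines} {q} 1≤f lines*l q²≤4l 2^N≤
     , List.lookup Y , lookup-injective unique , λ i → balanced⇒globalMin incidence t {List.lookup Y i} (bal (∈-lookup i)))
   -- A balanced `B` other than `A` would lie at distance at least `2 ^ f`, so within `2 ^ f ∸ 1`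
   -- every other assignment is unbalanced and strictly higher.
   , λ A min B 1≤dist dist≤ → unbalanced⇒above-globalMin incidence t {S₀} (bal S₀∈Y) {A} {B} min λ balB →
       ℕP.<-irrefl refl (ℕP.<-≤-trans (ℕP.≤-<-trans dist≤ (ℕP.≤-reflexive (ℕP.suc-pred (2 ^ f) {{ℕP.m^n≢0 2 f}})))
         (balanced-distance (cubes l f k) t {A} {B}
           (globalMin⇒balanced incidence t {S₀} (bal S₀∈Y) {A} min) balB 1≤dist))
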